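{- Let $n\ge 6$ be an integer and let $K(n,3)$ be the Kneser graph whose vertices are the $3$-element subsets of $[n]=\{1,\ldots,n\}$, two vertices being adjacent if and only if they are disjoint. Then \[ \mathrm{gp}(K(n,3)) = \begin{cases} 20, & n=6,\\ \binom{n-1}{2}, & n\ge 7. \end{cases} \]
   Context: Graphs are finite, undirected and simple. For a graph $G$, $d_G$ is the shortest-path distance; a $u,v$-geodesic is a $u,v$-path of length $d_G(u,v)$ (vertices in different connected components are joined by no geodesic). A set $S\subseteq V(G)$ is a general position set of $G$ if no vertex of $S$ lies on a geodesic between two other vertices of $S$; that is, for no three pairwise different $u,v,w\in S$ lying in one connected component does $d_G(u,v)=d_G(u,w)+d_G(w,v)$ hold. The general position number $\mathrm{gp}(G)$ is the maximum cardinality of a general position set of $G$. -}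

module Defs where

open import Data.Fin.Subset using (Subset; inside; outside; ∣_∣; _∩_; Empty)
open import Data.Fin.Subset.Properties using (Empty-unique; ∣⊥∣≡0; ∩-idem; ∩-comm)
open import Data.List.Base using (List; []; _∷_; _++_; map; length)
open import Data.List.Membership.Propositional using (_∈_)
open import Data.List.Membership.Propositional.Properties
  using (∈-map⁺; ∈-++⁺ˡ; ∈-++⁺ʳ)
open import Data.List.Relation.Unary.Any using (here)
open import Data.List.Relation.Unary.Enumerates.Setoid using (IsEnumeration)
open import Data.List.Relation.Unary.Unique.Propositional using (Unique)
open import Data.Nat.Base using (ℕ; zero; suc; _+_; _≤_; NonZero; ≢-nonZero⁻¹)
open import Data.Product.Base using (Σ-syntax; _×_; _,_)
open import Data.Vec.Base using ([]; _∷_)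
open import Relation.Binary.Definitions using (Symmetric; Irreflexive)
open import Relation.Binary.PropositionalEquality
  using (_≡_; _≢_; refl; sym; trans; cong; subst; setoid)

record Graph : Set₁ where
  infix 4 _~_
  field
    V        : Set
    _~_      : V → V → Set
    ~-sym    : Symmetric _~_
    ~-irrefl : Irreflexive _≡_ _~_
    finite   : Σ[ xs ∈ List V ] IsEnumeration (setoid V) xs

module _ (G : Graph) where
  open Graph G

  data Walk : V → V → ℕ → Set where
    nil  : ∀ {u} → Walk u u 0
    cons : ∀ {u v w k} → u ~ v → Walk v w k → Walk u w (suc k)

  vertices : ∀ {u v k} → Walk u v k → List V
  vertices {u} nil        = u ∷ []
  vertices {u} (cons _ p) = u ∷ vertices p

  Path : V → V → ℕ → Set
  Path u v k = Σ[ p ∈ Walk u v k ] Unique (vertices p)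

  -- "d_G(u,v) = k", as a relation: it holds for no k when u and v lie in
  -- different connected components.
  Distance : V → V → ℕ → Set
  Distance u v k = Path u v k × (∀ l → Path u v l → k ≤ l)

  -- Sets of vertices are represented by lists; Unique is imposed in IsGpNumber,
  -- so that length is the cardinality.  Requiring the three distances to exist
  -- restricts the condition to triples lying in one connected component.
  GeneralPosition : List V → Set
  GeneralPosition S =
    ∀ {u v w} → u ∈ S → v ∈ S → w ∈ S → u ≢ v → u ≢ w → v ≢ w →
    ∀ {duv duw dwv} → Distance u v duv → Distance u w duw → Distance w v dwv →
    duv ≢ duw + dwv

  -- "gp(G) = k", as a relation.
  IsGpNumber : ℕ → Set
  IsGpNumber k =
    (Σ[ S ∈ List V ] (Unique S × GeneralPosition S × length S ≡ k)) ×
    (∀ S → Unique S → GeneralPosition S → length S ≤ k)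

-- Proofs of ∣ p ∣ ≡ k are unique, so equality of these pairs is equality of
-- the underlying subsets.
SubsetOfSize : ℕ → ℕ → Set
SubsetOfSize n k = Σ[ p ∈ Subset n ] ∣ p ∣ ≡ k

private
  add : ∀ {n k} → SubsetOfSize n k → SubsetOfSize (suc n) (suc k)
  add (p , eq) = inside ∷ p , cong suc eq

  skip : ∀ {n k} → SubsetOfSize n k → SubsetOfSize (suc n) k
  skip (p , eq) = outside ∷ p , eq

allOfSize : ∀ n k → List (SubsetOfSize n k)
allOfSize zero    zero    = ([] , refl) ∷ []
allOfSize zero    (suc k) = []
allOfSize (suc n) zero    = map skip (allOfSize n zero)
allOfSize (suc n) (suc k) = map add (allOfSize n k) ++ map skip (allOfSize n (suc k))

allOfSize-complete : ∀ n k → IsEnumeration (setoid (SubsetOfSize n k)) (allOfSize n k)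
allOfSize-complete zero    zero    ([] , refl) = here refl
allOfSize-complete (suc n) zero    (outside ∷ p , eq) =
  ∈-map⁺ skip (allOfSize-complete n zero (p , eq))
allOfSize-complete (suc n) (suc k) (inside ∷ p , refl) =
  ∈-++⁺ˡ (∈-map⁺ add (allOfSize-complete n k (p , refl)))
allOfSize-complete (suc n) (suc k) (outside ∷ p , eq) =
  ∈-++⁺ʳ (map add (allOfSize n k))
    (∈-map⁺ skip (allOfSize-complete n (suc k) (p , eq)))

-- For k = 0 the empty set would be disjoint from itself, giving a loop.
Kneser : ∀ n k → .{{NonZero k}} → Graph
Kneser n k = record
  { V        = SubsetOfSize n k
  ; _~_      = λ (p , _) (q , _) → Empty (p ∩ q)
  ; ~-sym    = λ { {p , _} {q , _} → subst Empty (∩-comm p q) }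
  ; ~-irrefl = λ { {p , eq} refl p∩p-empty → ≢-nonZero⁻¹ k
      (trans (sym eq)
        (trans (cong ∣_∣ (Empty-unique (subst Empty (∩-idem p) p∩p-empty)))
               (∣⊥∣≡0 n))) }
  ; finite   = allOfSize n k , allOfSize-complete n k
  }

{-# OPTIONS --safe #-}
module Submission where

-- For n ≥ 8 the diameter of K(n,3) is 2, so in a general position set no member is disjoint from two
-- different intersecting members.  If no two members are disjoint, the bound is the Erdős–Ko–Rado
-- theorem.  It is proved by induction on n: the vertices of K(7,3) split into five heptagons, and for
-- n ≥ 8 some point lies on at most n − 2 members and can be deleted.  If A and B are disjoint members,
-- then for n ≥ 9 one of any two points outside A ∪ B lies on at most 7 members.  For n = 8 every further
-- member meets both A and B; if x and y are the two outer points and a ∈ A, b ∈ B, then the members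
-- among xab, yab (counted twice) and the four triples of (A ∪ B) ∖ {a,b} number at most 4, and adding
-- up over a and b leaves at most 20 members.  For n = 7 distance 3 occurs as well: it forces every member
-- other than A and B to be the outer point with one point of A and one of B, and there are only 9 of those.
-- The lower bound is a star; K(6,3) is a perfect matching.

open import Defs
open import Agda.Builtin.FromNat using (Number; fromNat)
open import Data.Bool.Base using (Bool; true; false; T)
open import Data.Empty using (⊥)
open import Data.Fin.Base using (Fin; zero; suc)
import Data.Fin.Literals as FinLiterals
open import Data.Fin.Properties using () renaming (_≟_ to _≟ᶠ_)
open import Data.Fin.Subset
  using (Subset; inside; outside; ∣_∣; _∩_; _∪_; ⁅_⁆; Empty) renaming (_∈_ to _∈ˢ_; _∉_ to _∉ˢ_)
open import Data.Fin.Subset.Properties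
  using (⊆-antisym; nonempty?; x∈p∩q⁺; x∈p∩q⁻; x∈p∪q⁺; x∈p∪q⁻; x∈⁅x⁆; x∈⁅y⁆⇒x≡y; ∩-comm)
open import Data.List.Base
  using (List; []; _∷_; _++_; map; length; lookup; concat; tabulate; take; allFin; cartesianProduct)
open import Data.List.Membership.DecPropositional using (_∈?_)
open import Data.List.Membership.Propositional using (_∈_; find; lose)
open import Data.List.Membership.Propositional.Properties
  using (∈-lookup; ∈-∃++; ∈-map⁻; ∈-++⁻; ∈-allFin; ∈-length)
open import Data.List.Properties
  using (map-++; map-cong; map-∘; map-tabulate; length-map; length-++; length-take; length-tabulate)
open import Data.List.Relation.Binary.Disjoint.Propositional using (Disjoint)
open import Data.List.Relation.Binary.Permutation.Propositional
  using (_↭_; refl; prep; swap; trans; ↭-sym; ↭⇒↭ₛ)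
open import Data.List.Relation.Binary.Permutation.Propositional.Properties
  using (map⁺; ∈-resp-↭; ++⁺; ++⁺ˡ; ++⁺ʳ; shift; ↭-length)
import Data.List.Relation.Binary.Permutation.Setoid.Properties as Permutationₛ
open import Data.List.Relation.Unary.All using (All; []; _∷_)
import Data.List.Relation.Unary.All as All
import Data.List.Relation.Unary.All.Properties as Allₚ
open import Data.List.Relation.Unary.AllPairs using ([]; _∷_)
import Data.List.Relation.Unary.AllPairs as AllPairs
open import Data.List.Relation.Unary.Any using (here; there; any?)
open import Data.List.Relation.Unary.Unique.DecPropositional using (unique?)
open import Data.List.Relation.Unary.Unique.Propositional using (Unique)
import Data.List.Relation.Unary.Unique.Propositional.Properties as Uniqueₚ
open import Data.Maybe.Base using (Maybe; just; nothing; is-just)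
import Data.Maybe.Base as Maybe
open import Data.Nat.Base using (ℕ; zero; suc; _+_; _*_; _∸_; _≤_; z≤n; s≤s; s≤s⁻¹)
open import Data.Nat.Combinatorics using (_C_; nCk+nC[k+1]≡[n+1]C[k+1]; nC1≡n)
open import Data.Nat.ListAction using (sum)
open import Data.Nat.ListAction.Properties using (sum-++; sum-↭)
import Data.Nat.Literals as ℕLiterals
open import Data.Nat.Properties
open import Data.Nat.Tactic.RingSolver using (solve-∀)
open import Data.Product.Base using (Σ-syntax; ∃-syntax; _×_; _,_; proj₁; proj₂; map₂)
open import Data.Product.Properties using (≡-dec)
open import Data.Sum.Base using (_⊎_; inj₁; inj₂)
open import Data.Unit.Base using (tt)
import Data.Vec.Base as Vec
open import Data.Vec.Properties using ([]=⇒lookup; lookup⇒[]=; ∷-injectiveʳ)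
open import Function.Base using (_∘_)
open import Relation.Binary.Definitions using (DecidableEquality)
open import Relation.Binary.PropositionalEquality
  using (_≡_; _≢_; refl; sym; cong; cong₂; subst; setoid; module ≡-Reasoning) renaming (trans to ≡-trans)
open import Relation.Nullary.Decidable using (yes; no; True; toWitness; ¬?)
open import Relation.Nullary.Negation using (¬_; contradiction)

-- A set of triples is handled through a counting function on points, so that its size is a sum over
-- the unordered triples of a list of points. Splitting off the head of the list gives degree plus
-- remainder, and invariance under permutations turns each choice made without loss of generality
-- into a rearrangement of the list. The constant n - 2 comes from C(n-1,2) = (n-2) + C(n-2,2):
-- deleting a point of at most that degree preserves the bound. Geodesics depend on n, so the
-- inductions do not carry general position itself but combinatorial consequences of it: members
-- pairwise meet, or no member is disjoint from two others that meet. Both are conditions on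
-- distinct points and pass to sublists. With two disjoint members, deletion cannot go below eight
-- points, because the degree bound 7 exceeds n - 2 = 6 there. The weighted cover on eight points
-- takes over: double weights make the two extremes equal, namely all four triples of one four-point
-- set against both x a b and y a b.

instance
  ℕ-literals : Number ℕ
  ℕ-literals = ℕLiterals.number

  Fin-literals : ∀ {n} → Number (Fin n)
  Fin-literals {n} = FinLiterals.number n

private variable
  A B V W : Set
  n : ℕ

≢0-or-≡0 : ∀ {P : Set} (n : ℕ) → (n ≢ 0 → P) → (n ≡ 0 → P) → P
≢0-or-≡0 zero    _ z = z refl
≢0-or-≡0 (suc n) p _ = p λ ()

≡0-by-contradiction : ∀ {n : ℕ} → ¬ (n ≢ 0) → n ≡ 0
≡0-by-contradiction {zero}  _ = refl
≡0-by-contradiction {suc n} h = contradiction (λ ()) h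

≢0-+ : ∀ {P : Set} (m : ℕ) {n} → m + n ≢ 0 → (m ≢ 0 → P) → (n ≢ 0 → P) → P
≢0-+ zero    m+n≢0 _ p = p m+n≢0
≢0-+ (suc m) m+n≢0 p _ = p λ ()

interchange : ∀ a b c d → a + b + (c + d) ≡ a + c + (b + d)
interchange = solve-∀

-- Sums over the elements, unordered pairs and unordered triples of a list

sum₁ : (A → ℕ) → List A → ℕ
sum₁ h xs = sum (map h xs)

sum₂ : (A → A → ℕ) → List A → ℕ
sum₂ h []       = 0
sum₂ h (x ∷ xs) = sum₁ (h x) xs + sum₂ h xs

sum₃ : (A → A → A → ℕ) → List A → ℕ
sum₃ h []       = 0
sum₃ h (x ∷ xs) = sum₂ (h x) xs + sum₃ h xs

sum₁-cong : ∀ {g h : A → ℕ} → (∀ x → g x ≡ h x) → ∀ xs → sum₁ g xs ≡ sum₁ h xs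
sum₁-cong g≗h xs = cong sum (map-cong g≗h xs)

sum₁-++ : ∀ (h : A → ℕ) xs ys → sum₁ h (xs ++ ys) ≡ sum₁ h xs + sum₁ h ys
sum₁-++ h xs ys = ≡-trans (cong sum (map-++ h xs ys)) (sum-++ (map h xs) (map h ys))

sum₁-↭ : ∀ (h : A → ℕ) {xs ys} → xs ↭ ys → sum₁ h xs ≡ sum₁ h ys
sum₁-↭ h xs↭ys = sum-↭ (map⁺ h xs↭ys)

sum₂-↭ : ∀ {h : A → A → ℕ} → (∀ x y → h x y ≡ h y x) →
         ∀ {xs ys} → xs ↭ ys → sum₂ h xs ≡ sum₂ h ys
sum₂-↭ h-sym refl        = refl
sum₂-↭ h-sym (prep x p)  = cong₂ _+_ (sum₁-↭ _ p) (sum₂-↭ h-sym p)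
sum₂-↭ h-sym (trans p q) = ≡-trans (sum₂-↭ h-sym p) (sum₂-↭ h-sym q)
sum₂-↭ {h = h} h-sym (swap {xs} {ys} x y p)
  rewrite sum₁-↭ (h x) p | sum₁-↭ (h y) p | sum₂-↭ h-sym p | h-sym x y =
  interchange (h y x) (sum₁ (h x) ys) (sum₁ (h y) ys) (sum₂ h ys)

sum₃-↭ : ∀ {h : A → A → A → ℕ} → (∀ x y z → h x y z ≡ h y x z) → (∀ x y z → h x y z ≡ h x z y) →
         ∀ {xs ys} → xs ↭ ys → sum₃ h xs ≡ sum₃ h ys
sum₃-↭ h-swap₁ h-swap₂ refl        = refl
sum₃-↭ h-swap₁ h-swap₂ (prep x p)  = cong₂ _+_ (sum₂-↭ (h-swap₂ x) p) (sum₃-↭ h-swap₁ h-swap₂ p)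
sum₃-↭ h-swap₁ h-swap₂ (trans p q) =
  ≡-trans (sum₃-↭ h-swap₁ h-swap₂ p) (sum₃-↭ h-swap₁ h-swap₂ q)
sum₃-↭ {h = h} h-swap₁ h-swap₂ (swap {xs} {ys} x y p)
  rewrite sum₁-↭ (h x y) p | sum₁-cong (h-swap₁ x y) ys | sum₂-↭ (h-swap₂ x) p
        | sum₂-↭ (h-swap₂ y) p | sum₃-↭ h-swap₁ h-swap₂ p =
  interchange (sum₁ (h y x) ys) (sum₂ (h x) ys) (sum₂ (h y) ys) (sum₃ h ys)

-- The witness comes with a rearrangement that brings it to the front, so that sums and distinctness
-- can be carried along the same permutation.
pick₁ : ∀ (h : A → ℕ) xs → sum₁ h xs ≢ 0 → ∃[ x ] ∃[ ys ] xs ↭ x ∷ ys × h x ≢ 0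
pick₁ h []       s≢0 = contradiction refl s≢0
pick₁ h (x ∷ xs) s≢0 = ≢0-+ (h x) s≢0
  (λ hx≢0 → x , xs , refl , hx≢0)
  (λ t≢0 → let y , ys , p , hy≢0 = pick₁ h xs t≢0 in
     y , x ∷ ys , trans (prep x p) (swap x y refl) , hy≢0)

pick₂ : ∀ (h : A → A → ℕ) xs → sum₂ h xs ≢ 0 →
        ∃[ x ] ∃[ y ] ∃[ zs ] xs ↭ x ∷ y ∷ zs × h x y ≢ 0
pick₂ h []       s≢0 = contradiction refl s≢0
pick₂ h (x ∷ xs) s≢0 = ≢0-+ (sum₁ (h x) xs) s≢0
  (λ t≢0 → let y , ys , p , hxy≢0 = pick₁ (h x) xs t≢0 in x , y , ys , prep x p , hxy≢0)
  (λ t≢0 → let y , z , zs , p , hyz≢0 = pick₂ h xs t≢0 in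
     y , z , x ∷ zs , trans (prep x p) (↭-sym (shift x (y ∷ z ∷ []) zs)) , hyz≢0)

pick₃ : ∀ (h : A → A → A → ℕ) xs → sum₃ h xs ≢ 0 →
        ∃[ x ] ∃[ y ] ∃[ z ] ∃[ ws ] xs ↭ x ∷ y ∷ z ∷ ws × h x y z ≢ 0
pick₃ h []       s≢0 = contradiction refl s≢0
pick₃ h (x ∷ xs) s≢0 = ≢0-+ (sum₂ (h x) xs) s≢0
  (λ t≢0 → let y , z , zs , p , hxyz≢0 = pick₂ (h x) xs t≢0 in x , y , z , zs , prep x p , hxyz≢0)
  (λ t≢0 → let y , z , w , ws , p , hyzw≢0 = pick₃ h xs t≢0 in
     y , z , w , x ∷ ws , trans (prep x p) (↭-sym (shift x (y ∷ z ∷ w ∷ []) ws)) , hyzw≢0)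

sum₁≡0 : ∀ (h : A → ℕ) xs → (∀ {x ys} → xs ↭ x ∷ ys → h x ≡ 0) → sum₁ h xs ≡ 0
sum₁≡0 h xs zeros = ≡0-by-contradiction λ s≢0 →
  let _ , _ , p , hx≢0 = pick₁ h xs s≢0 in hx≢0 (zeros p)

sum₂≡0 : ∀ (h : A → A → ℕ) xs → (∀ {x y zs} → xs ↭ x ∷ y ∷ zs → h x y ≡ 0) → sum₂ h xs ≡ 0
sum₂≡0 h xs zeros = ≡0-by-contradiction λ s≢0 →
  let _ , _ , _ , p , hxy≢0 = pick₂ h xs s≢0 in hxy≢0 (zeros p)

sum₃≡0 : ∀ (h : A → A → A → ℕ) xs → (∀ {x y z ws} → xs ↭ x ∷ y ∷ z ∷ ws → h x y z ≡ 0) →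
         sum₃ h xs ≡ 0
sum₃≡0 h xs zeros = ≡0-by-contradiction λ s≢0 →
  let _ , _ , _ , _ , p , hxyz≢0 = pick₃ h xs s≢0 in hxyz≢0 (zeros p)

cross : (A → A → ℕ) → List A → List A → ℕ
cross h xs ys = sum₁ (λ x → sum₁ (h x) ys) xs

sum₂-++ : ∀ (h : A → A → ℕ) xs ys →
          sum₂ h (xs ++ ys) ≡ sum₂ h xs + cross h xs ys + sum₂ h ys
sum₂-++ h []       ys = refl
sum₂-++ h (x ∷ xs) ys rewrite sum₁-++ (h x) xs ys | sum₂-++ h xs ys =
  regroup (sum₁ (h x) xs) (sum₁ (h x) ys) (sum₂ h xs) (cross h xs ys) (sum₂ h ys)
  where
  regroup : ∀ a b c d e → a + b + (c + d + e) ≡ a + c + (b + d) + e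
  regroup = solve-∀

sum₃-++ : ∀ (h : A → A → A → ℕ) xs ys →
          sum₃ h (xs ++ ys) ≡
          sum₃ h xs + sum₂ (λ x y → sum₁ (h x y) ys) xs + sum₁ (λ x → sum₂ (h x) ys) xs + sum₃ h ys
sum₃-++ h []       ys = refl
sum₃-++ h (x ∷ xs) ys rewrite sum₂-++ (h x) xs ys | sum₃-++ h xs ys =
  regroup (sum₂ (h x) xs) (cross (h x) xs ys) (sum₂ (h x) ys)
          (sum₃ h xs) (sum₂ (λ x y → sum₁ (h x y) ys) xs) (sum₁ (λ x → sum₂ (h x) ys) xs) (sum₃ h ys)
  where
  regroup : ∀ a b c d e f g → a + b + c + (d + e + f + g) ≡ a + d + (b + e) + (c + f) + g
  regroup = solve-∀

-- Lists without repetition and explicit lists of triples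

Unique-resp-↭ : ∀ {xs ys : List A} → xs ↭ ys → Unique xs → Unique ys
Unique-resp-↭ p = Permutationₛ.Unique-resp-↭ (setoid _) (↭⇒↭ₛ p)

lookup-injective : ∀ {xs : List A} → Unique xs → ∀ {i j} → lookup xs i ≡ lookup xs j → i ≡ j
lookup-injective (_ ∷ _)   {zero}  {zero}  _  = refl
lookup-injective (x∉ ∷ _)  {zero}  {suc j} eq = contradiction eq (All.lookup x∉ (∈-lookup j))
lookup-injective (x∉ ∷ _)  {suc i} {zero}  eq = contradiction (sym eq) (All.lookup x∉ (∈-lookup i))
lookup-injective (_ ∷ uxs) {suc i} {suc j} eq = cong suc (lookup-injective uxs eq)

-- Lets distinctness of points taken from a list be decided on their positions.
select : ∀ {xs : List A} → Unique xs → (is : List (Fin (length xs))) → {True (unique? _≟ᶠ_ is)} →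
         Unique (map (lookup xs) is)
select uxs is {distinct} = Uniqueₚ.map⁺ (lookup-injective uxs) (toWitness distinct)

Unique-++⁻ : ∀ (xs : List A) {ys} → Unique (xs ++ ys) → Unique xs × Unique ys × Disjoint xs ys
Unique-++⁻ []       u        = [] , u , λ ()
Unique-++⁻ (x ∷ xs) (x∉ ∷ u) with Unique-++⁻ xs u | Allₚ.++⁻ xs x∉
... | uxs , uys , d | x∉xs , x∉ys = x∉xs ∷ uxs , uys , λ where
  (here refl , v∈ys) → All.lookup x∉ys v∈ys refl
  (there v∈xs , v∈ys) → d (v∈xs , v∈ys)

-- Positions can be compared by evaluation only in the explicit prefix, so the unknown tail is
-- carried along unchanged.
reorder : ∀ (xs : List A) {ys} → Unique (xs ++ ys) → (is : List (Fin (length xs))) →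
          {True (unique? _≟ᶠ_ is)} → Unique (map (lookup xs) is ++ ys)
reorder xs u is {distinct} with Unique-++⁻ xs u
... | uxs , uys , d = Uniqueₚ.++⁺ (select uxs is {distinct}) uys λ (v∈is , v∈ys) →
  let i , _ , eq = ∈-map⁻ (lookup xs) v∈is in d (subst (_∈ xs) (sym eq) (∈-lookup i) , v∈ys)

pairs : List A → List (A × A)
pairs []       = []
pairs (x ∷ xs) = map (x ,_) xs ++ pairs xs

triples : List A → List (A × A × A)
triples []       = []
triples (x ∷ xs) = map (x ,_) (pairs xs) ++ triples xs

sum₁-map : ∀ (h : B → ℕ) (g : A → B) xs → sum₁ h (map g xs) ≡ sum₁ (h ∘ g) xs
sum₁-map h g xs = cong sum (sym (map-∘ xs))

sum₂-pairs : ∀ (h : A × A → ℕ) xs → sum₂ (λ x y → h (x , y)) xs ≡ sum₁ h (pairs xs)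
sum₂-pairs h []       = refl
sum₂-pairs h (x ∷ xs)
  rewrite sum₁-++ h (map (x ,_) xs) (pairs xs) | sum₁-map h (x ,_) xs | sum₂-pairs h xs = refl

sum₃-triples : ∀ (h : A × A × A → ℕ) xs →
               sum₃ (λ x y z → h (x , y , z)) xs ≡ sum₁ h (triples xs)
sum₃-triples h []       = refl
sum₃-triples h (x ∷ xs)
  rewrite sum₁-++ h (map (x ,_) (pairs xs)) (triples xs) | sum₁-map h (x ,_) (pairs xs)
        | sum₂-pairs (h ∘ (x ,_)) xs | sum₃-triples h xs = refl

module _ (_≟_ : DecidableEquality A) where

  submultiset? : ∀ xs ys → Maybe (∃[ zs ] ys ↭ xs ++ zs)
  submultiset? []       ys = just (ys , refl)
  submultiset? (x ∷ xs) ys with _∈?_ _≟_ x ys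
  ... | no _     = nothing
  ... | yes x∈ys with ∈-∃++ x∈ys
  ...   | as , bs , refl =
    Maybe.map (λ (zs , p) → zs , trans (shift x as bs) (prep x p)) (submultiset? xs (as ++ bs))

  -- For closed lists the implicit argument is solved by running the search, so a covering by
  -- explicit triples needs no written proof.
  sum₁-submultiset : ∀ (h : A → ℕ) xs ys → {T (is-just (submultiset? xs ys))} →
                     sum₁ h xs ≤ sum₁ h ys
  sum₁-submultiset h xs ys with submultiset? xs ys
  ... | just (zs , p) rewrite sum₁-↭ h p | sum₁-++ h xs zs = m≤m+n (sum₁ h xs) (sum₁ h zs)

-- A family of 3-sets, f i j k being 1 or 0 according to whether {i,j,k} belongs to it; nothing is
-- required of f when two of the points coincide.
record TripleSystem (V : Set) : Set where
  field
    f       : V → V → V → ℕ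
    f-swap₁ : ∀ i j k → f i j k ≡ f j i k
    f-swap₂ : ∀ i j k → f i j k ≡ f i k j
    f≤1     : ∀ {i j k} → Unique (i ∷ j ∷ k ∷ []) → f i j k ≤ 1

  size : List V → ℕ
  size = sum₃ f

  f′ : V × V × V → ℕ
  f′ (i , j , k) = f i j k

  size-↭ : ∀ {xs ys} → xs ↭ ys → size xs ≡ size ys
  size-↭ = sum₃-↭ f-swap₁ f-swap₂

  degree-↭ : ∀ x {xs ys} → xs ↭ ys → sum₂ (f x) xs ≡ sum₂ (f x) ys
  degree-↭ x = sum₂-↭ (f-swap₂ x)

open TripleSystem

-- Renames points by their positions in a list, which makes explicit covers over `Fin 7` and `Fin 8`
-- available for arbitrary points.
pullback : (g : W → V) → (∀ {x y} → g x ≡ g y → x ≡ y) → TripleSystem V → TripleSystem W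
pullback g g-inj F .f i j k       = f F (g i) (g j) (g k)
pullback g g-inj F .f-swap₁ i j k = f-swap₁ F (g i) (g j) (g k)
pullback g g-inj F .f-swap₂ i j k = f-swap₂ F (g i) (g j) (g k)
pullback g g-inj F .f≤1 u         = f≤1 F (Uniqueₚ.map⁺ g-inj u)

Intersecting : TripleSystem V → Set
Intersecting F = ∀ {i j k l m n} → Unique (i ∷ j ∷ k ∷ l ∷ m ∷ n ∷ []) →
                 f F i j k ≢ 0 → f F l m n ≡ 0

-- Intersecting systems on seven points

_≟³_ : ∀ {n} → DecidableEquality (Fin n × Fin n × Fin n)
_≟³_ = ≡-dec _≟ᶠ_ (≡-dec _≟ᶠ_ _≟ᶠ_)

_⊕_ : A × A × A → A × A × A → List A
(i , j , k) ⊕ (l , m , n) = i ∷ j ∷ k ∷ l ∷ m ∷ n ∷ []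

exclusive⇒+≤1 : ∀ {m n} → m ≤ 1 → n ≤ 1 → (m ≢ 0 → n ≡ 0) → m + n ≤ 1
exclusive⇒+≤1 {zero}  m≤1 n≤1 _ = n≤1
exclusive⇒+≤1 {suc m} m≤1 n≤1 e rewrite e (λ ()) | +-identityʳ m = m≤1

Distinct : List (Fin 7) → Set
Distinct is = True (unique? _≟ᶠ_ is)

sum₁-concat-≤ : ∀ (h : A → ℕ) {c} xss → All (λ xs → sum₁ h xs ≤ c) xss →
                sum₁ h (concat xss) ≤ length xss * c
sum₁-concat-≤ h []         []       = z≤n
sum₁-concat-≤ h (xs ∷ xss) (b ∷ bs) rewrite sum₁-++ h xs (concat xss) =
  +-mono-≤ b (sum₁-concat-≤ h xss bs)

-- The graph K(7,3) splits into five cycles of length 7, each with independence number 3.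
heptagons : List (List (Fin 7 × Fin 7 × Fin 7))
heptagons =
  ((0 , 1 , 2) ∷ (3 , 4 , 5) ∷ (0 , 1 , 6) ∷ (2 , 3 , 4) ∷ (0 , 5 , 6) ∷ (1 , 2 , 3) ∷ (4 , 5 , 6) ∷ []) ∷
  ((0 , 1 , 3) ∷ (2 , 4 , 5) ∷ (0 , 3 , 6) ∷ (1 , 2 , 4) ∷ (3 , 5 , 6) ∷ (0 , 1 , 4) ∷ (2 , 5 , 6) ∷ []) ∷
  ((0 , 1 , 5) ∷ (2 , 3 , 6) ∷ (1 , 4 , 5) ∷ (0 , 2 , 6) ∷ (1 , 3 , 4) ∷ (0 , 2 , 5) ∷ (3 , 4 , 6) ∷ []) ∷
  ((0 , 2 , 3) ∷ (1 , 4 , 6) ∷ (2 , 3 , 5) ∷ (0 , 4 , 6) ∷ (1 , 2 , 5) ∷ (0 , 3 , 4) ∷ (1 , 5 , 6) ∷ []) ∷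
  ((0 , 2 , 4) ∷ (1 , 3 , 5) ∷ (2 , 4 , 6) ∷ (0 , 3 , 5) ∷ (1 , 2 , 6) ∷ (0 , 4 , 5) ∷ (1 , 3 , 6) ∷ []) ∷ []

module _ (F : TripleSystem (Fin 7)) (intersecting : Intersecting F) where

  disjoint-pair : ∀ s t → Distinct (s ⊕ t) → f′ F s + f′ F t ≤ 1
  disjoint-pair s t d with u@((≢₁ ∷ ≢₂ ∷ _) ∷ (≢₃ ∷ _) ∷ _ ∷ u₃) ← toWitness d =
    exclusive⇒+≤1 (f≤1 F ((≢₁ ∷ ≢₂ ∷ []) ∷ (≢₃ ∷ []) ∷ [] ∷ [])) (f≤1 F u₃) (intersecting u)

  -- Twice the sum runs over the seven edges of the cycle, each contributing at most 1, and 2x ≤ 7 <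
  -- 8 forces x ≤ 3.
  heptagon : ∀ {a b c d e g h} →
    {Distinct (a ⊕ b)} → {Distinct (b ⊕ c)} → {Distinct (c ⊕ d)} → {Distinct (d ⊕ e)} →
    {Distinct (e ⊕ g)} → {Distinct (g ⊕ h)} → {Distinct (h ⊕ a)} →
    sum₁ (f′ F) (a ∷ b ∷ c ∷ d ∷ e ∷ g ∷ h ∷ []) ≤ 3
  heptagon {a} {b} {c} {d} {e} {g} {h} {ab} {bc} {cd} {de} {eg} {gh} {ha} = s≤s⁻¹ (*-cancelˡ-< 2 _ 4 (begin-strict
    2 * sum₁ (f′ F) (a ∷ b ∷ c ∷ d ∷ e ∷ g ∷ h ∷ [])
      ≡⟨ double (f′ F a) (f′ F b) (f′ F c) (f′ F d) (f′ F e) (f′ F g) (f′ F h) ⟩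
    (f′ F a + f′ F b) + ((f′ F b + f′ F c) + ((f′ F c + f′ F d) + ((f′ F d + f′ F e) +
      ((f′ F e + f′ F g) + ((f′ F g + f′ F h) + (f′ F h + f′ F a))))))
      ≤⟨ +-mono-≤ (disjoint-pair a b ab) (+-mono-≤ (disjoint-pair b c bc)
        (+-mono-≤ (disjoint-pair c d cd) (+-mono-≤ (disjoint-pair d e de)
        (+-mono-≤ (disjoint-pair e g eg) (+-mono-≤ (disjoint-pair g h gh) (disjoint-pair h a ha)))))) ⟩
    7 <⟨ n<1+n 7 ⟩
    8 ∎))
    where
    open ≤-Reasoning
    double : ∀ a b c d e g h → 2 * (a + (b + (c + (d + (e + (g + (h + 0))))))) ≡
      (a + b) + ((b + c) + ((c + d) + ((d + e) + ((e + g) + ((g + h) + (h + a))))))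
    double = solve-∀

  -- The cycles exhaust all 35 triples, and 5 · 3 is exactly C(6,2).
  intersecting₇ : size F (allFin 7) ≤ 15
  intersecting₇ = begin
    size F (allFin 7)                 ≡⟨ sum₃-triples (f′ F) (allFin 7) ⟩
    sum₁ (f′ F) (triples (allFin 7))  ≤⟨ sum₁-submultiset _≟³_ (f′ F) (triples (allFin 7)) (concat heptagons) ⟩
    sum₁ (f′ F) (concat heptagons)    ≤⟨ sum₁-concat-≤ (f′ F) heptagons
                                           (heptagon ∷ heptagon ∷ heptagon ∷ heptagon ∷ heptagon ∷ []) ⟩
    15                                ∎
    where open ≤-Reasoning

sum₁-≤-length : ∀ (h : A → ℕ) xs → (∀ {x ys} → xs ↭ x ∷ ys → h x ≤ 1) → sum₁ h xs ≤ length xs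
sum₁-≤-length h []       bound = z≤n
sum₁-≤-length h (x ∷ xs) bound =
  +-mono-≤ (bound refl) (sum₁-≤-length h xs λ p → bound (trans (prep x p) (swap x _ refl)))

≤0 : ∀ {n} → n ≡ 0 → n ≤ 0
≤0 = ≤-reflexive

uncons : ∀ (xs : List A) {n} → length xs ≡ suc n → ∃[ y ] ∃[ ys ] xs ≡ y ∷ ys × length ys ≡ n
uncons (y ∷ ys) |xs| = y , ys , refl , suc-injective |xs|

↭-pair : ∀ {x y z : A} {ws} → x ∷ y ∷ [] ↭ z ∷ ws → ∃[ w ] ws ≡ w ∷ []
↭-pair {ws = []}        p = contradiction (↭-length p) λ ()
↭-pair {ws = w ∷ []}    p = w , refl
↭-pair {ws = _ ∷ _ ∷ _} p = contradiction (↭-length p) λ ()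

suc-C₂ : ∀ n → suc n C 2 ≡ n + n C 2
suc-C₂ n = ≡-trans (sym (nCk+nC[k+1]≡[n+1]C[k+1] n 1)) (cong (_+ n C 2) (nC1≡n n))

-- Intersecting systems

record Removable (F : TripleSystem V) (xs : List V) (d : ℕ) : Set where
  constructor removable
  field
    {point}  : V
    {others} : List V
    split    : xs ↭ point ∷ others
    degree≤  : sum₂ (f F point) others ≤ d

open Removable

Removable-↭ : ∀ {F : TripleSystem V} {xs ys d} → xs ↭ ys → Removable F ys d → Removable F xs d
Removable-↭ p (removable q b) = removable (trans p q) b

size-removable : ∀ (F : TripleSystem V) {xs d} (r : Removable F xs d) →
                 size F xs ≤ d + size F (others r)
size-removable F (removable p b) rewrite size-↭ F p = +-monoˡ-≤ _ b

module _ (F : TripleSystem V) where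

  -- A single value is read as a sum over a two-point list, so that invariance of sums replaces an
  -- analysis of the permutation.
  f-pair-↭ : ∀ {a x y z w} → x ∷ y ∷ [] ↭ z ∷ w ∷ [] → f F a x y ≢ 0 → f F a z w ≢ 0
  f-pair-↭ {a} {x} {y} {z} {w} p faxy≢0 fazw≡0 = faxy≢0 (begin
    f F a x y                  ≡⟨ lone (f F a x y) ⟩
    sum₂ (f F a) (x ∷ y ∷ [])  ≡⟨ degree-↭ F a p ⟩
    sum₂ (f F a) (z ∷ w ∷ [])  ≡⟨ lone (f F a z w) ⟨
    f F a z w                  ≡⟨ fazw≡0 ⟩
    0                          ∎)
    where
    open ≡-Reasoning
    lone : ∀ n → n ≡ n + 0 + 0
    lone = solve-∀

module _ (F : TripleSystem V) (meet : Intersecting F) where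

  private
    g : V → V → V → ℕ
    g = f F

  ekr₇ : ∀ {a b c d e h i} → Unique (a ∷ b ∷ c ∷ d ∷ e ∷ h ∷ i ∷ []) →
         size F (a ∷ b ∷ c ∷ d ∷ e ∷ h ∷ i ∷ []) ≤ 15
  ekr₇ {a} {b} {c} {d} {e} {h} {i} u =
    intersecting₇ (pullback (lookup xs) (lookup-injective u) F)
      (λ v → meet (Uniqueₚ.map⁺ (lookup-injective u) v))
    where xs = a ∷ b ∷ c ∷ d ∷ e ∷ h ∷ i ∷ []

  -- A member made of `x` and two points of `xs` would be disjoint from `i j k`.
  missing : ∀ {i j k x xs} → Unique (i ∷ j ∷ k ∷ x ∷ xs) → g i j k ≢ 0 → sum₂ (g x) xs ≡ 0
  missing {i} {j} {k} {x} {xs} u ijk = sum₂≡0 (g x) xs λ p →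
    meet (Uniqueₚ.take⁺ 6 (Unique-resp-↭ (++⁺ˡ (i ∷ j ∷ k ∷ x ∷ []) p) u)) ijk

  missing₁ : ∀ {i j k x y xs} → Unique (i ∷ j ∷ k ∷ x ∷ y ∷ xs) → g i j k ≢ 0 →
             sum₁ (g x y) xs ≡ 0
  missing₁ u ijk = m+n≡0⇒m≡0 _ (missing u ijk)

  -- A member through `y` needs a pair meeting all three given members. There are six: a p, a q, a
  -- x, and p q, p q₁, p₁ q.
  fan-triangle : ∀ {a p p₁ q q₁ x y R} → Unique (a ∷ p ∷ p₁ ∷ q ∷ q₁ ∷ x ∷ y ∷ R) →
    g a p p₁ ≢ 0 → g a q q₁ ≢ 0 → g x p q ≢ 0 →
    sum₂ (g y) (a ∷ p ∷ p₁ ∷ q ∷ q₁ ∷ x ∷ R) ≤ 6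
  fan-triangle {a} {p} {p₁} {q} {q₁} {x} {y} {R} u app aqq xpq =
    +-mono-≤ (+-mono-≤ (f≤1 F (select u (6 ∷ 0 ∷ 1 ∷ [])))
             (+-mono-≤ (≤0 (meet (select u (5 ∷ 1 ∷ 3 ∷ 6 ∷ 0 ∷ 2 ∷ [])) xpq))
             (+-mono-≤ (f≤1 F (select u (6 ∷ 0 ∷ 3 ∷ [])))
             (+-mono-≤ (≤0 (meet (select u (5 ∷ 1 ∷ 3 ∷ 6 ∷ 0 ∷ 4 ∷ [])) xpq))
             (+-mono-≤ (f≤1 F (select u (6 ∷ 0 ∷ 5 ∷ [])))
                       (≤0 (missing₁ (reorder ps u (5 ∷ 1 ∷ 3 ∷ 6 ∷ 0 ∷ [])) xpq)))))))
   (+-mono-≤ (+-mono-≤ (≤0 (meet (select u (0 ∷ 3 ∷ 4 ∷ 6 ∷ 1 ∷ 2 ∷ [])) aqq))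
             (+-mono-≤ (f≤1 F (select u (6 ∷ 1 ∷ 3 ∷ [])))
             (+-mono-≤ (f≤1 F (select u (6 ∷ 1 ∷ 4 ∷ [])))
                       (≤0 (missing₁ (reorder ps u (0 ∷ 3 ∷ 4 ∷ 6 ∷ 1 ∷ 5 ∷ [])) aqq)))))
   (+-mono-≤ (+-mono-≤ (f≤1 F (select u (6 ∷ 2 ∷ 3 ∷ [])))
             (+-mono-≤ (≤0 (meet (select u (5 ∷ 1 ∷ 3 ∷ 6 ∷ 2 ∷ 4 ∷ [])) xpq))
                       (≤0 (missing₁ (reorder ps u (0 ∷ 3 ∷ 4 ∷ 6 ∷ 2 ∷ 5 ∷ [])) aqq))))
             (≤0 (missing (reorder ps u (0 ∷ 1 ∷ 2 ∷ 6 ∷ 3 ∷ 4 ∷ 5 ∷ [])) app))))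
    where
    ps : List V
    ps = a ∷ p ∷ p₁ ∷ q ∷ q₁ ∷ x ∷ y ∷ []

  -- Either all triples through x contain a, or some triple x p q does not, and then
  -- every further point y lies on at most six triples.
  low-degree-at-cross : ∀ {a b b₁ c c₁ x y R} → Unique (a ∷ b ∷ b₁ ∷ c ∷ c₁ ∷ x ∷ y ∷ R) →
    g a b b₁ ≢ 0 → g a c c₁ ≢ 0 → 1 ≤ length R →
    Removable F (a ∷ b ∷ b₁ ∷ c ∷ c₁ ∷ x ∷ y ∷ R) (5 + length R)
  low-degree-at-cross {a} {b} {b₁} {c} {c₁} {x} {y} {R} u abb acc 1≤R =
    ≢0-or-≡0 (cross (g x) (b ∷ b₁ ∷ []) (c ∷ c₁ ∷ [])) degree-y degree-x
    where
    ps : List V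
    ps = a ∷ b ∷ b₁ ∷ c ∷ c₁ ∷ x ∷ y ∷ []

    degree-x : cross (g x) (b ∷ b₁ ∷ []) (c ∷ c₁ ∷ []) ≡ 0 → Removable F (ps ++ R) (5 + length R)
    degree-x none = removable (shift x (a ∷ b ∷ b₁ ∷ c ∷ c₁ ∷ []) (y ∷ R)) (begin
      sum₂ (g x) (a ∷ b ∷ b₁ ∷ c ∷ c₁ ∷ y ∷ R)
        ≡⟨ cong (sum₁ (g x a) (b ∷ b₁ ∷ c ∷ c₁ ∷ y ∷ R) +_) rest ⟩
      sum₁ (g x a) (b ∷ b₁ ∷ c ∷ c₁ ∷ y ∷ R) + 0
        ≡⟨ +-identityʳ _ ⟩
      sum₁ (g x a) (b ∷ b₁ ∷ c ∷ c₁ ∷ y ∷ R)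
        ≤⟨ sum₁-≤-length (g x a) (b ∷ b₁ ∷ c ∷ c₁ ∷ y ∷ R)
             (λ p → f≤1 F (Uniqueₚ.take⁺ 3 (Unique-resp-↭ (++⁺ˡ (x ∷ a ∷ []) p)
               (reorder ps u (5 ∷ 0 ∷ 1 ∷ 2 ∷ 3 ∷ 4 ∷ 6 ∷ []))))) ⟩
      5 + length R ∎)
      where
      open ≤-Reasoning
      -- A pair avoiding `a` must meet both {b, b₁} and {c, c₁}, and `none` says that no such pair
      -- forms a member with `x`.
      rest : sum₂ (g x) (b ∷ b₁ ∷ c ∷ c₁ ∷ y ∷ R) ≡ 0
      rest
        with through-b ← m+n≡0⇒m≡0 (sum₁ (g x b) (c ∷ c₁ ∷ [])) none
        with through-b₁ ← m+n≡0⇒m≡0 (sum₁ (g x b₁) (c ∷ c₁ ∷ []))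
               (m+n≡0⇒n≡0 (sum₁ (g x b) (c ∷ c₁ ∷ [])) none) =
        cong₂ _+_ (cong₂ _+_ (meet (select u (0 ∷ 3 ∷ 4 ∷ 5 ∷ 1 ∷ 2 ∷ [])) acc)
                  (cong₂ _+_ (m+n≡0⇒m≡0 (g x b c) through-b)
                  (cong₂ _+_ (m+n≡0⇒m≡0 (g x b c₁) (m+n≡0⇒n≡0 (g x b c) through-b))
                             (missing₁ (reorder ps u (0 ∷ 3 ∷ 4 ∷ 5 ∷ 1 ∷ 6 ∷ [])) acc))))
       (cong₂ _+_ (cong₂ _+_ (m+n≡0⇒m≡0 (g x b₁ c) through-b₁)
                  (cong₂ _+_ (m+n≡0⇒m≡0 (g x b₁ c₁) (m+n≡0⇒n≡0 (g x b₁ c) through-b₁))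
                             (missing₁ (reorder ps u (0 ∷ 3 ∷ 4 ∷ 5 ∷ 2 ∷ 6 ∷ [])) acc)))
                  (missing (reorder ps u (0 ∷ 1 ∷ 2 ∷ 5 ∷ 3 ∷ 4 ∷ 6 ∷ [])) abb))

    degree-y : cross (g x) (b ∷ b₁ ∷ []) (c ∷ c₁ ∷ []) ≢ 0 → Removable F (ps ++ R) (5 + length R)
    degree-y some
      with p , ps₁ , b↭ , s≢0 ← pick₁ _ (b ∷ b₁ ∷ []) some
      with q , qs₁ , c↭ , xpq≢0 ← pick₁ (g x p) (c ∷ c₁ ∷ []) s≢0
      with p₁ , refl ← ↭-pair b↭ | q₁ , refl ← ↭-pair c↭ =
      Removable-↭ relabel (removable
        (shift y (a ∷ p ∷ p₁ ∷ q ∷ q₁ ∷ x ∷ []) R)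
        (≤-trans (fan-triangle (Unique-resp-↭ relabel u) (f-pair-↭ F b↭ abb) (f-pair-↭ F c↭ acc) xpq≢0)
                 -- Six is at most 5 + `length R` only from eight points on; this is why seven
                 -- points form the base case.
                 (+-monoʳ-≤ 5 1≤R)))
      where
      relabel : a ∷ b ∷ b₁ ∷ c ∷ c₁ ∷ x ∷ y ∷ R ↭ a ∷ p ∷ p₁ ∷ q ∷ q₁ ∷ x ∷ y ∷ R
      relabel = prep a (++⁺ b↭ (++⁺ʳ (x ∷ y ∷ R) c↭))

  -- `crossed` yields a second member meeting the first in `a` alone; two further points serve as
  -- `x` and `y`.
  low-degree-crossed : ∀ {a b c R} → Unique (a ∷ b ∷ c ∷ R) → g a b c ≢ 0 → sum₂ (g a) R ≢ 0 →
    ∀ {m} → length R ≡ 5 + m → Removable F (a ∷ b ∷ c ∷ R) (6 + m)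
  low-degree-crossed {a} {b} {c} {R} u abc crossed {m} |R|
    with d , e , zs , p , ade ← pick₂ (g a) R crossed
    with x , zs₁ , refl , |zs| ← uncons zs (suc-injective (suc-injective (≡-trans (sym (↭-length p)) |R|)))
    with y , S , refl , |S| ← uncons zs₁ |zs| =
    Removable-↭ q (subst (Removable F _) (cong (5 +_) |S|)
      (low-degree-at-cross (Unique-resp-↭ q u) abc ade (≤-trans (m≤m+n 1 m) (≤-reflexive (sym |S|)))))
    where
    q : a ∷ b ∷ c ∷ R ↭ a ∷ b ∷ c ∷ d ∷ e ∷ x ∷ y ∷ S
    q = ++⁺ˡ (a ∷ b ∷ c ∷ []) p

  -- Every member meets `a b c`, and by hypothesis never in one point only. A member through `x` is
  -- therefore `x` with one of the three pairs of `a b c`.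
  low-degree-uncrossed : ∀ {a b c x R} → Unique (a ∷ b ∷ c ∷ x ∷ R) → g a b c ≢ 0 →
    sum₂ (g a) (x ∷ R) ≡ 0 → sum₂ (g b) (x ∷ R) ≡ 0 → sum₂ (g c) (x ∷ R) ≡ 0 →
    sum₂ (g x) (a ∷ b ∷ c ∷ R) ≤ 3
  low-degree-uncrossed {a} {b} {c} {x} {R} u abc a≡0 b≡0 c≡0 =
    +-mono-≤ (+-mono-≤ (f≤1 F (select u (3 ∷ 0 ∷ 1 ∷ [])))
             (+-mono-≤ (f≤1 F (select u (3 ∷ 0 ∷ 2 ∷ []))) (through a a≡0)))
   (+-mono-≤ (+-mono-≤ (f≤1 F (select u (3 ∷ 1 ∷ 2 ∷ []))) (through b b≡0))
   (+-mono-≤ (through c c≡0) (≤0 (missing u abc))))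
    where
    through : ∀ y → sum₂ (g y) (x ∷ R) ≡ 0 → sum₁ (g x y) R ≤ 0
    through y y≡0 = ≤0 (≡-trans (sum₁-cong (f-swap₁ F x y) R) (m+n≡0⇒m≡0 _ y≡0))

  -- Each of `a`, `b`, `c` in turn is tested as the single common point of two members; if all fail,
  -- any fourth point has degree at most 3.
  low-degree : ∀ {xs m} → Unique xs → length xs ≡ 8 + m → Removable F xs (6 + m)
  low-degree {xs@(x ∷ ys)} {m} u |xs| = ≢0-or-≡0 (size F xs) nonempty
    λ s≡0 → removable refl (≤-trans (≤0 (m+n≡0⇒m≡0 (sum₂ (g x) ys) s≡0)) z≤n)
    where
    nonempty : size F xs ≢ 0 → Removable F xs (6 + m)
    nonempty s≢0
      with a , b , c , R , p , abc ← pick₃ g xs s≢0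
      with y , R , refl , |R| ← uncons R (suc-injective (suc-injective (suc-injective
             (≡-trans (sym (↭-length p)) |xs|)))) =
      ≢0-or-≡0 (sum₂ (g a) (y ∷ R))
        (λ crossed → Removable-↭ p (low-degree-crossed ua abc crossed (cong suc |R|)))
        λ a≡0 → ≢0-or-≡0 (sum₂ (g b) (y ∷ R))
        (λ crossed → Removable-↭ (trans p (swap a b refl)) (low-degree-crossed
          (reorder (a ∷ b ∷ c ∷ []) ua (1 ∷ 0 ∷ 2 ∷ [])) (abc ∘ ≡-trans (f-swap₁ F a b c)) crossed (cong suc |R|)))
        λ b≡0 → ≢0-or-≡0 (sum₂ (g c) (y ∷ R))
        (λ crossed → Removable-↭ (trans p (trans (prep a (swap b c refl)) (swap a c refl))) (low-degree-crossed
          (reorder (a ∷ b ∷ c ∷ []) ua (2 ∷ 0 ∷ 1 ∷ []))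
          (abc ∘ ≡-trans (f-swap₂ F a b c) ∘ ≡-trans (f-swap₁ F a c b)) crossed (cong suc |R|)))
        λ c≡0 → Removable-↭ p (removable (shift y (a ∷ b ∷ c ∷ []) R)
          (≤-trans (low-degree-uncrossed ua abc a≡0 b≡0 c≡0) (m≤m+n 3 (3 + m))))
      where
      ua : Unique (a ∷ b ∷ c ∷ y ∷ R)
      ua = Unique-resp-↭ p u

  ekr : ∀ m {xs} → Unique xs → length xs ≡ 7 + m → size F xs ≤ (6 + m) C 2
  ekr zero    {_ ∷ _ ∷ _ ∷ _ ∷ _ ∷ _ ∷ _ ∷ []} u |xs| = ekr₇ u
  ekr (suc m) {xs} u |xs| with low-degree u (≡-trans |xs| (+-suc 7 m))
  ... | r@(removable p _) = begin
    size F xs                   ≤⟨ size-removable F r ⟩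
    6 + m + size F (others r)   ≤⟨ +-monoʳ-≤ (6 + m)
                                     (ekr m (AllPairs.tail (Unique-resp-↭ p u))
                                       (suc-injective (≡-trans (sym (↭-length p)) (≡-trans |xs| (+-suc 7 m))))) ⟩
    6 + m + (6 + m) C 2         ≡⟨ suc-C₂ (6 + m) ⟨
    suc (6 + m) C 2             ≡⟨ cong (_C 2) (+-suc 6 m) ⟨
    (6 + suc m) C 2             ∎
    where open ≤-Reasoning

-- Systems containing two disjoint triples

cross-↭ : ∀ (h : A → A → ℕ) {xs xs₁ ys ys₁} → xs ↭ xs₁ → ys ↭ ys₁ → cross h xs ys ≡ cross h xs₁ ys₁
cross-↭ h {xs} p q = ≡-trans (sum₁-cong (λ x → sum₁-↭ (h x) q) xs) (sum₁-↭ _ p)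

cross-++ : ∀ (h : A → A → ℕ) xs ys zs → cross h xs (ys ++ zs) ≡ cross h xs ys + cross h xs zs
cross-++ h []       ys zs = refl
cross-++ h (x ∷ xs) ys zs rewrite sum₁-++ (h x) ys zs | cross-++ h xs ys zs =
  interchange (sum₁ (h x) ys) (sum₁ (h x) zs) (cross h xs ys) (cross h xs zs)

cross-product : ∀ (h : A × A → ℕ) xs ys →
                cross (λ x y → h (x , y)) xs ys ≡ sum₁ h (cartesianProduct xs ys)
cross-product h []       ys = refl
cross-product h (x ∷ xs) ys = sym (≡-trans (sum₁-++ h (map (_,_ x) ys) (cartesianProduct xs ys))
  (cong₂ _+_ (sum₁-map h (_,_ x) ys) (sym (cross-product h xs ys))))

-- The pairs with nonzero value are edges of a graph; a second edge would share an endpoint with the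
-- first, against `adjacent`, or miss it, against `remote`.
sum₂-≤1 : ∀ {h : A → A → ℕ} → (∀ x y → h x y ≡ h y x) → ∀ xs →
  (∀ {x y zs} → xs ↭ x ∷ y ∷ zs → h x y ≤ 1) →
  (∀ {x y z zs} → xs ↭ x ∷ y ∷ z ∷ zs → h x y ≢ 0 → h x z ≡ 0) →
  (∀ {x y z w zs} → xs ↭ x ∷ y ∷ z ∷ w ∷ zs → h x y ≢ 0 → h z w ≡ 0) →
  sum₂ h xs ≤ 1
sum₂-≤1 {h = h} h-sym xs h≤1 adjacent remote = ≢0-or-≡0 (sum₂ h xs) nonempty λ s≡0 → ≤-trans (≤0 s≡0) z≤n
  where
  open ≤-Reasoning
  nonempty : sum₂ h xs ≢ 0 → sum₂ h xs ≤ 1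
  nonempty s≢0 with x , y , zs , p , hxy ← pick₂ h xs s≢0 = begin
    sum₂ h xs                                                ≡⟨ sum₂-↭ h-sym p ⟩
    h x y + sum₁ (h x) zs + (sum₁ (h y) zs + sum₂ h zs)      ≤⟨ +-mono-≤ (+-mono-≤ (h≤1 p)
      (≤0 (sum₁≡0 _ zs λ q → adjacent (trans p (++⁺ˡ (x ∷ y ∷ []) q)) hxy)))
      (+-mono-≤ (≤0 (sum₁≡0 _ zs λ q → adjacent (trans p (trans (swap x y refl) (++⁺ˡ (y ∷ x ∷ []) q)))
                  (hxy ∘ ≡-trans (h-sym x y))))
                (≤0 (sum₂≡0 h zs λ q → remote (trans p (++⁺ˡ (x ∷ y ∷ []) q)) hxy))) ⟩
    1                                                        ∎

-- No member is disjoint from two different intersecting members; the latter share two points in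
-- meeting₂ and one point in meeting₁.
record PathFree (F : TripleSystem V) : Set where
  field
    meeting₂ : ∀ {i j k l m n o} → Unique (i ∷ j ∷ k ∷ l ∷ m ∷ n ∷ o ∷ []) →
               f F m n o ≢ 0 → f F i j k ≢ 0 → f F i j l ≡ 0
    meeting₁ : ∀ {i j k l m n o p} → Unique (i ∷ j ∷ k ∷ l ∷ m ∷ n ∷ o ∷ p ∷ []) →
               f F n o p ≢ 0 → f F i j k ≢ 0 → f F i l m ≡ 0

open PathFree

f-rotate : ∀ (F : TripleSystem V) i j k → f F i j k ≡ f F j k i
f-rotate F i j k = ≡-trans (f-swap₁ F i j k) (f-swap₂ F j i k)

pathFree-pullback : ∀ (g : W → V) (g-inj : ∀ {x y} → g x ≡ g y → x ≡ y) {F} →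
                    PathFree F → PathFree (pullback g g-inj F)
pathFree-pullback g g-inj free .meeting₂ u = meeting₂ free (Uniqueₚ.map⁺ g-inj u)
pathFree-pullback g g-inj free .meeting₁ u = meeting₁ free (Uniqueₚ.map⁺ g-inj u)

cell : (x y a b p q r s : V) → List (V × V × V)
cell x y a b p q r s =
  (x , a , b) ∷ (x , a , b) ∷ (y , a , b) ∷ (y , a , b) ∷ triples (p ∷ q ∷ r ∷ s ∷ [])

module _ (F : TripleSystem V) (free : PathFree F) where

  private
    g : V → V → V → ℕ
    g = f F

  -- A member through `x` that meets `a b c` and avoids `d e h` would make `d e h` disjoint from two
  -- members that meet. Two common points fall under `meeting₂`, one under `meeting₁`.
  beside : ∀ {a b c d e h x R} → Unique (a ∷ b ∷ c ∷ d ∷ e ∷ h ∷ x ∷ R) →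
           g a b c ≢ 0 → g d e h ≢ 0 →
           sum₂ (g x) (a ∷ b ∷ c ∷ []) ≡ 0 × cross (g x) (a ∷ b ∷ c ∷ []) R ≡ 0
  beside {a} {b} {c} {d} {e} {h} {x} {R} u abc deh =
    cong₂ _+_ (cong₂ _+_ (pair (reorder ps u (0 ∷ 1 ∷ 2 ∷ 3 ∷ 4 ∷ 5 ∷ 6 ∷ [])) abc)
              (cong₂ _+_ (pair (reorder ps u (0 ∷ 2 ∷ 1 ∷ 3 ∷ 4 ∷ 5 ∷ 6 ∷ [])) acb) refl))
              (cong₂ _+_ (cong₂ _+_ (pair (reorder ps u (1 ∷ 2 ∷ 0 ∷ 3 ∷ 4 ∷ 5 ∷ 6 ∷ [])) bca) refl) refl) ,
    cong₂ _+_ (single (reorder ps u (0 ∷ 1 ∷ 2 ∷ 3 ∷ 4 ∷ 5 ∷ 6 ∷ [])) abc)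
   (cong₂ _+_ (single (reorder ps u (1 ∷ 2 ∷ 0 ∷ 3 ∷ 4 ∷ 5 ∷ 6 ∷ [])) bca)
   (cong₂ _+_ (single (reorder ps u (2 ∷ 0 ∷ 1 ∷ 3 ∷ 4 ∷ 5 ∷ 6 ∷ [])) (bca ∘ ≡-trans (f-rotate F b c a))) refl))
    where
    ps : List V
    ps = a ∷ b ∷ c ∷ d ∷ e ∷ h ∷ x ∷ []
    acb : g a c b ≢ 0
    acb = abc ∘ ≡-trans (f-swap₂ F a b c)
    bca : g b c a ≢ 0
    bca = abc ∘ ≡-trans (f-rotate F a b c)
    pair : ∀ {i j k} → Unique (i ∷ j ∷ k ∷ d ∷ e ∷ h ∷ x ∷ R) → g i j k ≢ 0 → g x i j ≡ 0
    pair {i} {j} v ijk = ≡-trans (f-rotate F x i j)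
      (meeting₂ free (select v (0 ∷ 1 ∷ 2 ∷ 6 ∷ 3 ∷ 4 ∷ 5 ∷ [])) deh ijk)
    single : ∀ {i j k} → Unique (i ∷ j ∷ k ∷ d ∷ e ∷ h ∷ x ∷ R) → g i j k ≢ 0 → sum₁ (g x i) R ≡ 0
    single {i} {j} {k} v ijk = sum₁≡0 (g x i) R λ {r} q → ≡-trans (f-swap₁ F x i r)
      (meeting₁ free (select (Unique-resp-↭ (++⁺ˡ (i ∷ j ∷ k ∷ d ∷ e ∷ h ∷ x ∷ []) q) v)
        (0 ∷ 1 ∷ 2 ∷ 6 ∷ 7 ∷ 3 ∷ 4 ∷ 5 ∷ [])) deh ijk)

  -- By `beside` in both directions, a pair completing `x` to a member meets both given members or
  -- neither.
  degree-beside : ∀ {a b c d e h x R} → Unique (a ∷ b ∷ c ∷ d ∷ e ∷ h ∷ x ∷ R) →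
    g a b c ≢ 0 → g d e h ≢ 0 →
    sum₂ (g x) (a ∷ b ∷ c ∷ d ∷ e ∷ h ∷ R) ≡
    cross (g x) (a ∷ b ∷ c ∷ []) (d ∷ e ∷ h ∷ []) + sum₂ (g x) R
  degree-beside {a} {b} {c} {d} {e} {h} {x} {R} u abc deh
    with A₂ , A×R ← beside u abc deh
    with D₂ , D×R ← beside (reorder (a ∷ b ∷ c ∷ d ∷ e ∷ h ∷ []) u (3 ∷ 4 ∷ 5 ∷ 0 ∷ 1 ∷ 2 ∷ [])) deh abc
    = begin
    sum₂ (g x) (as ++ ds ++ R)
      ≡⟨ sum₂-++ (g x) as (ds ++ R) ⟩
    sum₂ (g x) as + cross (g x) as (ds ++ R) + sum₂ (g x) (ds ++ R)
      ≡⟨ cong₂ _+_ (cong₂ _+_ A₂ cross-as) (sum₂-++ (g x) ds R) ⟩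
    cross (g x) as ds + (sum₂ (g x) ds + cross (g x) ds R + sum₂ (g x) R)
      ≡⟨ cong (λ n → cross (g x) as ds + (n + sum₂ (g x) R)) (cong₂ _+_ D₂ D×R) ⟩
    cross (g x) as ds + sum₂ (g x) R ∎
    where
    open ≡-Reasoning
    as ds : List V
    as = a ∷ b ∷ c ∷ []
    ds = d ∷ e ∷ h ∷ []
    cross-as : cross (g x) as (ds ++ R) ≡ cross (g x) as ds
    cross-as = ≡-trans (cross-++ (g x) as ds R) (≡-trans (cong (cross (g x) as ds +_) A×R) (+-identityʳ _))

  -- All members counted contain `x` and are disjoint from `a b c`, so two of them would form a
  -- forbidden configuration.
  degree-remote : ∀ {a b c x R} → Unique (a ∷ b ∷ c ∷ x ∷ R) → g a b c ≢ 0 → sum₂ (g x) R ≤ 1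
  degree-remote {a} {b} {c} {x} {R} u abc = sum₂-≤1 (f-swap₂ F x) R
    (λ q → f≤1 F (select (via q) (3 ∷ 4 ∷ 5 ∷ [])))
    (λ q → meeting₂ free (select (via q) (3 ∷ 4 ∷ 5 ∷ 6 ∷ 0 ∷ 1 ∷ 2 ∷ [])) abc)
    (λ q → meeting₁ free (select (via q) (3 ∷ 4 ∷ 5 ∷ 6 ∷ 7 ∷ 0 ∷ 1 ∷ 2 ∷ [])) abc)
    where
    via : ∀ {S} → R ↭ S → Unique (a ∷ b ∷ c ∷ x ∷ S)
    via q = Unique-resp-↭ (++⁺ˡ (a ∷ b ∷ c ∷ x ∷ []) q) u

  -- Of the nine pairs, the four avoiding both `p` and `q` give triples that share `x` and are
  -- disjoint from `y p q`, so at most one of these is a member; the other five are counted in full.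
  cross≤6 : ∀ {p p₁ p₂ q q₁ q₂ x y} → Unique (p ∷ p₁ ∷ p₂ ∷ q ∷ q₁ ∷ q₂ ∷ x ∷ y ∷ []) →
            g y p q ≢ 0 → cross (g x) (p ∷ p₁ ∷ p₂ ∷ []) (q ∷ q₁ ∷ q₂ ∷ []) ≤ 6
  cross≤6 {p} {p₁} {p₂} {q} {q₁} {q₂} {x} {y} u ypq = begin
    cross (g x) (p ∷ p₁ ∷ p₂ ∷ []) (q ∷ q₁ ∷ q₂ ∷ [])
      ≡⟨ regroup (g x p q) (g x p q₁) (g x p q₂) (g x p₁ q) (g x p₁ q₁) (g x p₁ q₂)
                 (g x p₂ q) (g x p₂ q₁) (g x p₂ q₂) ⟩
    g x p q + (g x p q₁ + (g x p q₂ + (g x p₁ q + (g x p₂ q +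
      (g x p₁ q₁ + g x p₁ q₂ + (g x p₂ q₁ + g x p₂ q₂))))))
      ≤⟨ +-mono-≤ (f≤1 F (select u (6 ∷ 0 ∷ 3 ∷ []))) (+-mono-≤ (f≤1 F (select u (6 ∷ 0 ∷ 4 ∷ [])))
        (+-mono-≤ (f≤1 F (select u (6 ∷ 0 ∷ 5 ∷ []))) (+-mono-≤ (f≤1 F (select u (6 ∷ 1 ∷ 3 ∷ [])))
        (+-mono-≤ (f≤1 F (select u (6 ∷ 2 ∷ 3 ∷ [])))
          (exclusive⇒+≤1
            (row (select u (0 ∷ 1 ∷ 3 ∷ 4 ∷ 5 ∷ 6 ∷ 7 ∷ []))) (row (select u (0 ∷ 2 ∷ 3 ∷ 4 ∷ 5 ∷ 6 ∷ 7 ∷ [])))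
            λ r₁≢0 → ≢0-+ (g x p₁ q₁) r₁≢0
              (λ xpq → cong₂ _+_ (column (select u (6 ∷ 4 ∷ 1 ∷ 2 ∷ 7 ∷ 0 ∷ 3 ∷ [])) xpq)
                                 (meeting₁ free (select u (6 ∷ 1 ∷ 4 ∷ 2 ∷ 5 ∷ 7 ∷ 0 ∷ 3 ∷ [])) ypq xpq))
              (λ xpq → cong₂ _+_ (meeting₁ free (select u (6 ∷ 1 ∷ 5 ∷ 2 ∷ 4 ∷ 7 ∷ 0 ∷ 3 ∷ [])) ypq xpq)
                                 (column (select u (6 ∷ 5 ∷ 1 ∷ 2 ∷ 7 ∷ 0 ∷ 3 ∷ [])) xpq))))))) ⟩
    6 ∎
    where
    open ≤-Reasoning
    regroup : ∀ a b c d e h i j k → (a + (b + (c + 0))) + ((d + (e + (h + 0))) + ((i + (j + (k + 0))) + 0)) ≡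
      a + (b + (c + (d + (i + (e + h + (j + k))))))
    regroup = solve-∀
    row : ∀ {r} → Unique (p ∷ r ∷ q ∷ q₁ ∷ q₂ ∷ x ∷ y ∷ []) → g x r q₁ + g x r q₂ ≤ 1
    row v = exclusive⇒+≤1 (f≤1 F (select v (5 ∷ 1 ∷ 3 ∷ []))) (f≤1 F (select v (5 ∷ 1 ∷ 4 ∷ [])))
      (meeting₂ free (select v (5 ∷ 1 ∷ 3 ∷ 4 ∷ 6 ∷ 0 ∷ 2 ∷ [])) ypq)
    column : ∀ {r s t} → Unique (x ∷ r ∷ s ∷ t ∷ y ∷ p ∷ q ∷ []) → g x s r ≢ 0 → g x t r ≡ 0
    column {r} {s} {t} v xsr = ≡-trans (f-swap₂ F x t r)
      (meeting₂ free v ypq (xsr ∘ ≡-trans (f-swap₂ F x s r)))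

  -- If x a b is a member, then at most one of the triples in p q r s is; if y a b is one as well, none.
  cell≤4 : ∀ {x y a b p q r s} → Unique (x ∷ y ∷ a ∷ b ∷ p ∷ q ∷ r ∷ s ∷ []) →
           sum₁ (f′ F) (cell x y a b p q r s) ≤ 4
  cell≤4 {x} {y} {a} {b} {p} {q} {r} {s} u =
    bound (g x a b) (g y a b) (f≤1 F (select u (0 ∷ 2 ∷ 3 ∷ []))) (f≤1 F (select u (1 ∷ 2 ∷ 3 ∷ []))) Σ≤4
      (Σ≤1 (select u (0 ∷ 2 ∷ 3 ∷ 4 ∷ 5 ∷ 6 ∷ 7 ∷ []))) (Σ≤1 (select u (1 ∷ 2 ∷ 3 ∷ 4 ∷ 5 ∷ 6 ∷ 7 ∷ []))) Σ≡0
    where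
    pqrs : List V
    pqrs = p ∷ q ∷ r ∷ s ∷ []
    Σ : ℕ
    Σ = sum₁ (f′ F) (triples pqrs)
    -- Since k and l are 0 or 1, the sum is bounded by 0 + 4, 2 + 1 or 4 + 0.
    bound : ∀ k l → k ≤ 1 → l ≤ 1 → Σ ≤ 4 → (k ≢ 0 → Σ ≤ 1) → (l ≢ 0 → Σ ≤ 1) →
            (k ≢ 0 → l ≢ 0 → Σ ≡ 0) → k + (k + (l + (l + Σ))) ≤ 4
    bound zero    zero    _   _   Σ≤4 _    _    _ = Σ≤4
    bound zero    (suc l) _   l≤1 _   _    Σ≤1 _ with z≤n ← s≤s⁻¹ l≤1 =
      ≤-trans (+-monoʳ-≤ 2 (Σ≤1 λ ())) (m≤m+n 3 1)
    bound (suc k) zero    k≤1 _   _   Σ≤1 _    _ with z≤n ← s≤s⁻¹ k≤1 =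
      ≤-trans (+-monoʳ-≤ 2 (Σ≤1 λ ())) (m≤m+n 3 1)
    bound (suc k) (suc l) k≤1 l≤1 _   _    _    Σ≡0 with z≤n ← s≤s⁻¹ k≤1 | z≤n ← s≤s⁻¹ l≤1 =
      +-monoʳ-≤ 4 (≤0 (Σ≡0 (λ ()) λ ()))
    Σ≤4 : Σ ≤ 4
    Σ≤4 = +-mono-≤ (f≤1 F (select u (4 ∷ 5 ∷ 6 ∷ []))) (+-mono-≤ (f≤1 F (select u (4 ∷ 5 ∷ 7 ∷ [])))
         (+-mono-≤ (f≤1 F (select u (4 ∷ 6 ∷ 7 ∷ []))) (+-mono-≤ (f≤1 F (select u (5 ∷ 6 ∷ 7 ∷ []))) z≤n)))
    Σ≡size : Σ ≡ size F pqrs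
    Σ≡size = sym (sum₃-triples (f′ F) pqrs)
    -- Any two triples of a four-point set share two points, and `z a b` is disjoint from both.
    Σ≤1 : ∀ {z} → Unique (z ∷ a ∷ b ∷ pqrs) → g z a b ≢ 0 → Σ ≤ 1
    Σ≤1 {z} v zab = ≢0-or-≡0 Σ nonempty λ Σ≡0 → ≤-trans (≤0 Σ≡0) z≤n
      where
      nonempty : Σ ≢ 0 → Σ ≤ 1
      nonempty Σ≢0
        with i , j , k , ws , π , ijk ← pick₃ g pqrs (Σ≢0 ∘ ≡-trans Σ≡size)
        with l , ws₁ , refl , |ws₁| ← uncons ws (suc-injective (suc-injective (suc-injective (sym (↭-length π)))))
        with [] ← ws₁
        = begin
        Σ                                      ≡⟨ Σ≡size ⟩
        size F pqrs                            ≡⟨ size-↭ F π ⟩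
        size F (i ∷ j ∷ k ∷ l ∷ [])            ≤⟨ +-mono-≤ (+-mono-≤ (+-mono-≤ (f≤1 F (select w (3 ∷ 4 ∷ 5 ∷ [])))
            (+-mono-≤ (≤0 (meeting₂ free (select w (3 ∷ 4 ∷ 5 ∷ 6 ∷ 0 ∷ 1 ∷ 2 ∷ [])) zab ijk)) (z≤n {0})))
            (+-mono-≤ (+-mono-≤ (≤0 (meeting₂ free (select w (3 ∷ 5 ∷ 4 ∷ 6 ∷ 0 ∷ 1 ∷ 2 ∷ [])) zab ikj)) (z≤n {0}))
                      (z≤n {0})))
            (+-mono-≤ (+-mono-≤ (+-mono-≤ (≤0 (meeting₂ free (select w (4 ∷ 5 ∷ 3 ∷ 6 ∷ 0 ∷ 1 ∷ 2 ∷ [])) zab jki))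
                      (z≤n {0})) (z≤n {0})) (z≤n {0})) ⟩
        1                                      ∎
        where
        open ≤-Reasoning
        w : Unique (z ∷ a ∷ b ∷ i ∷ j ∷ k ∷ l ∷ [])
        w = Unique-resp-↭ (++⁺ˡ (z ∷ a ∷ b ∷ []) π) v
        ikj : g i k j ≢ 0
        ikj = ijk ∘ ≡-trans (f-swap₂ F i j k)
        jki : g j k i ≢ 0
        jki = ijk ∘ ≡-trans (f-rotate F i j k)
    -- Here `x a b` and `y a b` are the meeting members, and a triple in `p q r s` would be disjoint
    -- from both.
    Σ≡0 : g x a b ≢ 0 → g y a b ≢ 0 → Σ ≡ 0
    Σ≡0 xab yab = ≡-trans Σ≡size (sum₃≡0 g pqrs λ {i} {j} {k} π → ≡0-by-contradiction λ ijk →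
      yab (≡-trans (f-rotate F y a b) (meeting₂ free
        (select (Unique-resp-↭ (++⁺ˡ (x ∷ y ∷ a ∷ b ∷ []) π) u) (2 ∷ 3 ∷ 0 ∷ 1 ∷ 4 ∷ 5 ∷ 6 ∷ []))
        ijk (xab ∘ ≡-trans (f-rotate F x a b)))))

-- There is one cell for each choice of a in `A₈` and b in `B₈`; 0 and 1 are the outer points.
cells : List (List (Fin 8 × Fin 8 × Fin 8))
cells =
  cell 0 1 2 5 3 4 6 7 ∷ cell 0 1 2 6 3 4 5 7 ∷ cell 0 1 2 7 3 4 5 6 ∷
  cell 0 1 3 5 2 4 6 7 ∷ cell 0 1 3 6 2 4 5 7 ∷ cell 0 1 3 7 2 4 5 6 ∷
  cell 0 1 4 5 2 3 6 7 ∷ cell 0 1 4 6 2 3 5 7 ∷ cell 0 1 4 7 2 3 5 6 ∷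
  -- Four entries, so this list also has the bound 4 and the total is 10 · 4 = 2 · 20.
  ((2 , 3 , 4) ∷ (2 , 3 , 4) ∷ (5 , 6 , 7) ∷ (5 , 6 , 7) ∷ []) ∷ []

A₈ B₈ : List (Fin 8)
A₈ = 2 ∷ 3 ∷ 4 ∷ []
B₈ = 5 ∷ 6 ∷ 7 ∷ []

-- Each triple inside A₈ ∪ B₈ other than A₈ and B₈ lies in two of the cells, so that the cells
-- together with the last list cover core twice.
core : List (Fin 8 × Fin 8 × Fin 8)
core = map (0 ,_) (cartesianProduct A₈ B₈) ++ map (1 ,_) (cartesianProduct A₈ B₈) ++ triples (A₈ ++ B₈)

core≤20 : ∀ (F : TripleSystem (Fin 8)) → PathFree F → sum₁ (f′ F) core ≤ 20
core≤20 F free = *-cancelˡ-≤ 2 (begin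
  2 * sum₁ (f′ F) core                 ≡⟨ cong (sum₁ (f′ F) core +_) (+-identityʳ _) ⟩
  sum₁ (f′ F) core + sum₁ (f′ F) core  ≡⟨ sum₁-++ (f′ F) core core ⟨
  sum₁ (f′ F) (core ++ core)           ≤⟨ sum₁-submultiset _≟³_ (f′ F) (core ++ core) (concat cells) ⟩
  sum₁ (f′ F) (concat cells)           ≤⟨ sum₁-concat-≤ (f′ F) cells
    (cell≤4 F free distinct ∷ cell≤4 F free distinct ∷ cell≤4 F free distinct ∷
     cell≤4 F free distinct ∷ cell≤4 F free distinct ∷ cell≤4 F free distinct ∷
     cell≤4 F free distinct ∷ cell≤4 F free distinct ∷ cell≤4 F free distinct ∷
     +-mono-≤ (f≤1 F distinct) (+-mono-≤ (f≤1 F distinct)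
       (+-mono-≤ (f≤1 F distinct) (+-mono-≤ (f≤1 F distinct) z≤n))) ∷ []) ⟩
  40                                   ∎)
  where
  open ≤-Reasoning
  distinct : ∀ {is : List (Fin 8)} → {True (unique? _≟ᶠ_ is)} → Unique is
  distinct {is} {d} = toWitness d

nonintersecting₈ : ∀ (F : TripleSystem (Fin 8)) → PathFree F →
                   cross (f F 0) A₈ B₈ + (cross (f F 1) A₈ B₈ + size F (A₈ ++ B₈)) ≤ 20
nonintersecting₈ F free = begin
  cross (f F 0) A₈ B₈ + (cross (f F 1) A₈ B₈ + size F (A₈ ++ B₈))
    ≡⟨ cong₂ _+_ (through 0) (cong₂ _+_ (through 1) (sum₃-triples (f′ F) (A₈ ++ B₈))) ⟩
  sum₁ (f′ F) (map (0 ,_) A×B) + (sum₁ (f′ F) (map (1 ,_) A×B) + sum₁ (f′ F) (triples (A₈ ++ B₈)))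
    ≡⟨ cong (sum₁ (f′ F) (map (0 ,_) A×B) +_) (sum₁-++ (f′ F) (map (1 ,_) A×B) (triples (A₈ ++ B₈))) ⟨
  sum₁ (f′ F) (map (0 ,_) A×B) + sum₁ (f′ F) (map (1 ,_) A×B ++ triples (A₈ ++ B₈))
    ≡⟨ sum₁-++ (f′ F) (map (0 ,_) A×B) (map (1 ,_) A×B ++ triples (A₈ ++ B₈)) ⟨
  sum₁ (f′ F) core
    ≤⟨ core≤20 F free ⟩
  20 ∎
  where
  open ≤-Reasoning
  A×B : List (Fin 8 × Fin 8)
  A×B = cartesianProduct A₈ B₈
  through : ∀ x → cross (f F x) A₈ B₈ ≡ sum₁ (f′ F) (map (x ,_) A×B)
  through x = ≡-trans (cross-product (λ ij → f′ F (x , ij)) A₈ B₈) (sym (sum₁-map (f′ F) (x ,_) A×B))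

↭-triple : ∀ {x y z i : A} {ws} → x ∷ y ∷ z ∷ [] ↭ i ∷ ws → ∃[ j ] ∃[ k ] ws ≡ j ∷ k ∷ []
↭-triple {ws = []}            p = contradiction (↭-length p) λ ()
↭-triple {ws = _ ∷ []}        p = contradiction (↭-length p) λ ()
↭-triple {ws = j ∷ k ∷ []}    p = j , k , refl
↭-triple {ws = _ ∷ _ ∷ _ ∷ _} p = contradiction (↭-length p) λ ()

module _ (F : TripleSystem V) where

  private
    g : V → V → V → ℕ
    g = f F

  f-triple-↭ : ∀ {x y z i j k} → x ∷ y ∷ z ∷ [] ↭ i ∷ j ∷ k ∷ [] → g x y z ≢ 0 → g i j k ≢ 0
  f-triple-↭ {x} {y} {z} {i} {j} {k} p xyz ijk≡0 = xyz (begin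
    g x y z                  ≡⟨ lone (g x y z) ⟩
    size F (x ∷ y ∷ z ∷ [])  ≡⟨ size-↭ F p ⟩
    size F (i ∷ j ∷ k ∷ [])  ≡⟨ lone (g i j k) ⟨
    g i j k                  ≡⟨ ijk≡0 ⟩
    0                        ∎)
    where
    open ≡-Reasoning
    lone : ∀ n → n ≡ n + 0 + 0 + 0
    lone = solve-∀

  size-triple≤1 : ∀ {x y z} → Unique (x ∷ y ∷ z ∷ []) → size F (x ∷ y ∷ z ∷ []) ≤ 1
  size-triple≤1 u = +-mono-≤ (+-mono-≤ (+-mono-≤ (f≤1 F u) (z≤n {0})) (z≤n {0})) (z≤n {0})

module _ (F : TripleSystem V) (free : PathFree F) where

  private
    g : V → V → V → ℕ
    g = f F

  -- A triple containing both outer points meets exactly one of the two given members, so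
  -- `degree-beside` discards it; the rest is the sum over `core`.
  size₈ : ∀ {a b c d e h x y} → Unique (a ∷ b ∷ c ∷ d ∷ e ∷ h ∷ x ∷ y ∷ []) → g a b c ≢ 0 → g d e h ≢ 0 →
          size F (a ∷ b ∷ c ∷ d ∷ e ∷ h ∷ x ∷ y ∷ []) ≤ 20
  size₈ {a} {b} {c} {d} {e} {h} {x} {y} u abc deh = begin
    size F (ps ++ x ∷ y ∷ [])
      ≡⟨ size-↭ F (trans (shift x ps (y ∷ [])) (prep x (shift y ps []))) ⟩
    sum₂ (g x) (y ∷ ps) + (sum₂ (g y) ps + size F ps)
      ≡⟨ cong₂ _+_ (≡-trans (degree-↭ F x (↭-sym (shift y ps [])))
           (degree-beside F free u abc deh))
           (cong (_+ size F ps) (degree-beside F free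
             (select u (0 ∷ 1 ∷ 2 ∷ 3 ∷ 4 ∷ 5 ∷ 7 ∷ [])) abc deh)) ⟩
    (cross (g x) as ds + 0) + (cross (g y) as ds + 0 + size F ps)
      ≡⟨ cong₂ _+_ (+-identityʳ (cross (g x) as ds)) (cong (_+ size F ps) (+-identityʳ (cross (g y) as ds))) ⟩
    cross (g x) as ds + (cross (g y) as ds + size F ps)
      ≤⟨ nonintersecting₈ F₈ (pathFree-pullback (lookup xs) (lookup-injective v) free) ⟩
    20 ∎
    where
    open ≤-Reasoning
    as ds ps xs : List V
    as = a ∷ b ∷ c ∷ []
    ds = d ∷ e ∷ h ∷ []
    ps = as ++ ds
    xs = x ∷ y ∷ ps
    v : Unique xs
    v = select u (6 ∷ 7 ∷ 0 ∷ 1 ∷ 2 ∷ 3 ∷ 4 ∷ 5 ∷ [])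
    F₈ : TripleSystem (Fin 8)
    F₈ = pullback (lookup xs) (lookup-injective v) F

  -- `degree-beside` leaves through `x` only the nine mixed triples, and `spread` leaves off `x`
  -- only the two given members: 11 in all.
  size₇ : ∀ {a b c d e h x} → Unique (a ∷ b ∷ c ∷ d ∷ e ∷ h ∷ x ∷ []) → g a b c ≢ 0 → g d e h ≢ 0 →
    (∀ {i j k l m n o} → Unique (i ∷ j ∷ k ∷ l ∷ m ∷ n ∷ o ∷ []) →
       g i j k ≢ 0 → g l m n ≢ 0 → g i j l ≡ 0) →
    size F (a ∷ b ∷ c ∷ d ∷ e ∷ h ∷ x ∷ []) ≤ 15
  size₇ {a} {b} {c} {d} {e} {h} {x} u abc deh spread = begin
    size F (ps ++ x ∷ [])
      ≡⟨ size-↭ F (shift x ps []) ⟩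
    sum₂ (g x) ps + size F ps
      ≡⟨ cong₂ _+_ (degree-beside F free u abc deh) (sum₃-++ g as ds) ⟩
    cross (g x) as ds + 0 + (size F as + sum₂ (λ i j → sum₁ (g i j) ds) as + sum₁ (λ i → sum₂ (g i) ds) as + size F ds)
      ≤⟨ +-mono-≤
          (+-mono-≤ (+-mono-≤ (row≤3 (select u (6 ∷ 0 ∷ 3 ∷ 4 ∷ 5 ∷ [])))
                    (+-mono-≤ (row≤3 (select u (6 ∷ 1 ∷ 3 ∷ 4 ∷ 5 ∷ [])))
                    (+-mono-≤ (row≤3 (select u (6 ∷ 2 ∷ 3 ∷ 4 ∷ 5 ∷ []))) (z≤n {0})))) (z≤n {0}))
          (+-mono-≤ (+-mono-≤ (+-mono-≤ (size-triple≤1 F (select u (0 ∷ 1 ∷ 2 ∷ []))) (≤0 two-one)) (≤0 one-two))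
                    (size-triple≤1 F (select u (3 ∷ 4 ∷ 5 ∷ [])))) ⟩
    11
      ≤⟨ m≤m+n 11 4 ⟩
    15 ∎
    where
    open ≤-Reasoning
    as ds ps : List V
    as = a ∷ b ∷ c ∷ []
    ds = d ∷ e ∷ h ∷ []
    ps = as ++ ds
    row≤3 : ∀ {i} → Unique (x ∷ i ∷ ds) → sum₁ (g x i) ds ≤ 3
    row≤3 {i} v = sum₁-≤-length (g x i) ds λ q → f≤1 F (Uniqueₚ.take⁺ 3 (Unique-resp-↭ (++⁺ˡ (x ∷ i ∷ []) q) v))
    two-one : sum₂ (λ i j → sum₁ (g i j) ds) as ≡ 0
    two-one = sum₂≡0 _ as λ {i} {j} p → sum₁≡0 (g i j) ds λ q → spread-↭ p q
      where
      spread-↭ : ∀ {i j l ks ms} → as ↭ i ∷ j ∷ ks → ds ↭ l ∷ ms → g i j l ≡ 0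
      spread-↭ p q with _ , _ , refl ← ↭-triple p | _ , _ , refl ← ↭-triple q =
        spread (Unique-resp-↭ (++⁺ p (++⁺ʳ (x ∷ []) q)) u) (f-triple-↭ F p abc) (f-triple-↭ F q deh)
    one-two : sum₁ (λ i → sum₂ (g i) ds) as ≡ 0
    one-two = sum₁≡0 _ as λ {i} p → sum₂≡0 (g i) ds λ q → spread-↭ p q
      where
      spread-↭ : ∀ {i l m js ns} → as ↭ i ∷ js → ds ↭ l ∷ m ∷ ns → g i l m ≡ 0
      spread-↭ {i} {l} {m} p q with _ , _ , refl ← ↭-triple p | _ , _ , refl ← ↭-triple q =
        ≡-trans (f-rotate F i l m) (spread (select (Unique-resp-↭ (++⁺ p (++⁺ʳ (x ∷ []) q)) u)
          (3 ∷ 4 ∷ 5 ∷ 0 ∷ 1 ∷ 2 ∷ 6 ∷ [])) (f-triple-↭ F q deh) (f-triple-↭ F p abc))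

  -- If `y` forms a member with one point from each side, `cross≤6` applies to `x` and one remote
  -- member may be added. Otherwise `y` itself has at most its remote member.
  low-degree-outside : ∀ {a b c d e h x y R} → Unique (a ∷ b ∷ c ∷ d ∷ e ∷ h ∷ x ∷ y ∷ R) →
    g a b c ≢ 0 → g d e h ≢ 0 →
    sum₂ (g x) (a ∷ b ∷ c ∷ d ∷ e ∷ h ∷ y ∷ R) ≤ 7 ⊎ sum₂ (g y) (a ∷ b ∷ c ∷ d ∷ e ∷ h ∷ x ∷ R) ≤ 7
  low-degree-outside {a} {b} {c} {d} {e} {h} {x} {y} {R} u abc deh =
    ≢0-or-≡0 (cross (g y) as ds) (inj₁ ∘ degree-x) (inj₂ ∘ degree-y)
    where
    open ≤-Reasoning
    as ds ps : List V
    as = a ∷ b ∷ c ∷ []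
    ds = d ∷ e ∷ h ∷ []
    ps = as ++ ds ++ x ∷ y ∷ []
    degree-y : cross (g y) as ds ≡ 0 → sum₂ (g y) (as ++ ds ++ x ∷ R) ≤ 7
    degree-y none = begin
      sum₂ (g y) (as ++ ds ++ x ∷ R)
        ≡⟨ degree-beside F free (reorder ps u (0 ∷ 1 ∷ 2 ∷ 3 ∷ 4 ∷ 5 ∷ 7 ∷ 6 ∷ [])) abc deh ⟩
      cross (g y) as ds + sum₂ (g y) (x ∷ R)
        ≤⟨ +-mono-≤ (≤0 none) (degree-remote F free (reorder ps u (0 ∷ 1 ∷ 2 ∷ 7 ∷ 6 ∷ [])) abc) ⟩
      1 ≤⟨ m≤m+n 1 6 ⟩
      7 ∎
    degree-x : cross (g y) as ds ≢ 0 → sum₂ (g x) (as ++ ds ++ y ∷ R) ≤ 7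
    degree-x some
      with p , ws , as↭ , s≢0 ← pick₁ _ as some
      with q , zs , ds↭ , ypq ← pick₁ (g y p) ds s≢0
      with p₁ , p₂ , refl ← ↭-triple as↭ | q₁ , q₂ , refl ← ↭-triple ds↭ = begin
      sum₂ (g x) (as ++ ds ++ y ∷ R)
        ≡⟨ degree-beside F free u abc deh ⟩
      cross (g x) as ds + sum₂ (g x) (y ∷ R)
        ≡⟨ cong (_+ sum₂ (g x) (y ∷ R)) (cross-↭ (g x) as↭ ds↭) ⟩
      cross (g x) (p ∷ p₁ ∷ p₂ ∷ []) (q ∷ q₁ ∷ q₂ ∷ []) + sum₂ (g x) (y ∷ R)
        ≤⟨ +-mono-≤ (cross≤6 F free (Unique-resp-↭ (++⁺ as↭ (++⁺ʳ (x ∷ y ∷ []) ds↭)) (Uniqueₚ.take⁺ 8 u)) ypq)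
                    (degree-remote F free (reorder ps u (0 ∷ 1 ∷ 2 ∷ 6 ∷ 7 ∷ [])) abc) ⟩
      7 ∎

  -- Only points outside the two disjoint members are deleted, so these survive. The base value 20
  -- lies below C(7,2) = 21, and from nine points on 7 is at most n - 2.
  nonintersecting : ∀ m {a b c d e h R} → Unique (a ∷ b ∷ c ∷ d ∷ e ∷ h ∷ R) → g a b c ≢ 0 → g d e h ≢ 0 →
    length R ≡ 2 + m → size F (a ∷ b ∷ c ∷ d ∷ e ∷ h ∷ R) ≤ (7 + m) C 2
  nonintersecting zero    {R = _ ∷ _ ∷ []} u abc deh _ = ≤-trans (size₈ u abc deh) (m≤m+n 20 1)
  nonintersecting (suc m) {a} {b} {c} {d} {e} {h} {x ∷ y ∷ R} u abc deh |R| = begin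
    size F (ps ++ x ∷ y ∷ R)  ≤⟨ remove (low-degree-outside u abc deh) ⟩
    7 + (7 + m) C 2           ≤⟨ +-monoˡ-≤ ((7 + m) C 2) (m≤m+n 7 m) ⟩
    7 + m + (7 + m) C 2       ≡⟨ suc-C₂ (7 + m) ⟨
    suc (7 + m) C 2           ≡⟨ cong (_C 2) (+-suc 7 m) ⟨
    (7 + suc m) C 2           ∎
    where
    open ≤-Reasoning
    ps : List V
    ps = a ∷ b ∷ c ∷ d ∷ e ∷ h ∷ []
    remove : sum₂ (g x) (ps ++ y ∷ R) ≤ 7 ⊎ sum₂ (g y) (ps ++ x ∷ R) ≤ 7 →
             size F (ps ++ x ∷ y ∷ R) ≤ 7 + (7 + m) C 2
    remove (inj₁ x≤7) = ≤-trans (size-removable F (removable (shift x ps (y ∷ R)) x≤7))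
      (+-monoʳ-≤ 7 (nonintersecting m
        (reorder (ps ++ x ∷ y ∷ []) u (0 ∷ 1 ∷ 2 ∷ 3 ∷ 4 ∷ 5 ∷ 7 ∷ [])) abc deh (suc-injective |R|)))
    remove (inj₂ y≤7) = ≤-trans (size-removable F (removable
        (trans (++⁺ˡ ps (swap x y refl)) (shift y ps (x ∷ R))) y≤7))
      (+-monoʳ-≤ 7 (nonintersecting m
        (reorder (ps ++ x ∷ y ∷ []) u (0 ∷ 1 ∷ 2 ∷ 3 ∷ 4 ∷ 5 ∷ 6 ∷ [])) abc deh (suc-injective |R|)))

-- Rearranged enumerations and interchange of sums

extend : ∀ {xs ys : List A} → Unique xs → All (_∈ ys) xs → ∃[ zs ] ys ↭ xs ++ zs
extend {ys = ys} []          []            = ys , refl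
extend           (x∉ ∷ uxs) (x∈ys ∷ xs⊆) with ∈-∃++ x∈ys
... | as , bs , refl = map₂ (λ p → trans (shift _ as bs) (prep _ p))
  (extend uxs (All.zipWith (λ (x≢y , y∈) → drop-head x≢y (∈-resp-↭ (shift _ as bs) y∈)) (x∉ , xs⊆)))
  where
  drop-head : ∀ {x y : A} {zs} → x ≢ y → y ∈ x ∷ zs → y ∈ zs
  drop-head x≢y (here refl)  = contradiction refl x≢y
  drop-head x≢y (there y∈zs) = y∈zs

cover : ∀ {is : List (Fin n)} → Unique is → ∃[ js ] allFin n ↭ is ++ js
cover uis = extend uis (All.tabulate λ _ → ∈-allFin _)

cover-length : ∀ {is js : List (Fin n)} → allFin n ↭ is ++ js → length is + length js ≡ n
cover-length {is = is} {js} p = ≡-trans (sym (length-++ is)) (≡-trans (sym (↭-length p)) (length-tabulate _))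

sum₂-map : ∀ (h : B → B → ℕ) (g : A → B) xs → sum₂ h (map g xs) ≡ sum₂ (λ x y → h (g x) (g y)) xs
sum₂-map h g []       = refl
sum₂-map h g (x ∷ xs) = cong₂ _+_ (sum₁-map (h (g x)) g xs) (sum₂-map h g xs)

sum₃-map : ∀ (h : B → B → B → ℕ) (g : A → B) xs →
           sum₃ h (map g xs) ≡ sum₃ (λ x y z → h (g x) (g y) (g z)) xs
sum₃-map h g []       = refl
sum₃-map h g (x ∷ xs) = cong₂ _+_ (sum₂-map (h (g x)) g xs) (sum₃-map h g xs)

sum₁-* : ∀ c (h : A → ℕ) xs → sum₁ (λ x → c * h x) xs ≡ c * sum₁ h xs
sum₁-* c h []       = sym (*-zeroʳ c)
sum₁-* c h (x ∷ xs) rewrite sum₁-* c h xs = sym (*-distribˡ-+ c (h x) (sum₁ h xs))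

sum₂-* : ∀ c (h : A → A → ℕ) xs → sum₂ (λ x y → c * h x y) xs ≡ c * sum₂ h xs
sum₂-* c h []       = sym (*-zeroʳ c)
sum₂-* c h (x ∷ xs) rewrite sum₁-* c (h x) xs | sum₂-* c h xs =
  sym (*-distribˡ-+ c (sum₁ (h x) xs) (sum₂ h xs))

sum₁-+ : ∀ (g h : A → ℕ) xs → sum₁ (λ x → g x + h x) xs ≡ sum₁ g xs + sum₁ h xs
sum₁-+ g h []       = refl
sum₁-+ g h (x ∷ xs) rewrite sum₁-+ g h xs = interchange (g x) (h x) (sum₁ g xs) (sum₁ h xs)

sum₂-+ : ∀ (g h : A → A → ℕ) xs → sum₂ (λ x y → g x y + h x y) xs ≡ sum₂ g xs + sum₂ h xs
sum₂-+ g h []       = refl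
sum₂-+ g h (x ∷ xs) rewrite sum₁-+ (g x) (h x) xs | sum₂-+ g h xs =
  interchange (sum₁ (g x) xs) (sum₁ (h x) xs) (sum₂ g xs) (sum₂ h xs)

sum₃-+ : ∀ (g h : A → A → A → ℕ) xs → sum₃ (λ x y z → g x y z + h x y z) xs ≡ sum₃ g xs + sum₃ h xs
sum₃-+ g h []       = refl
sum₃-+ g h (x ∷ xs) rewrite sum₂-+ (g x) (h x) xs | sum₃-+ g h xs =
  interchange (sum₂ (g x) xs) (sum₂ (h x) xs) (sum₃ g xs) (sum₃ h xs)

sum₃-sum₁ : ∀ (φ : B → A → A → A → ℕ) ss xs →
            sum₃ (λ x y z → sum₁ (λ s → φ s x y z) ss) xs ≡ sum₁ (λ s → sum₃ (φ s) xs) ss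
sum₃-sum₁ φ []       xs = sum₃≡0 _ xs λ _ → refl
sum₃-sum₁ φ (s ∷ ss) xs =
  ≡-trans (sum₃-+ (φ s) (λ x y z → sum₁ (λ s → φ s x y z) ss) xs) (cong (sum₃ (φ s) xs +_) (sum₃-sum₁ φ ss xs))

-- Indicator functions of subsets

bit : Bool → ℕ
bit false = 0
bit true  = 1

χ₁ : Subset n → Fin n → ℕ
χ₁ p i = bit (Vec.lookup p i)

χ₂ : Subset n → Fin n → Fin n → ℕ
χ₂ p i j = χ₁ p i * χ₁ p j

χ₃ : Subset n → Fin n → Fin n → Fin n → ℕ
χ₃ p i j k = χ₁ p i * χ₂ p j k

tabulate-suc : ∀ n → _≡_ {A = List (Fin (suc n))} (tabulate suc) (map suc (allFin n))
tabulate-suc n = sym (map-tabulate (λ i → i) suc)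

sum-χ₁ : ∀ (p : Subset n) → sum₁ (χ₁ p) (allFin n) ≡ ∣ p ∣
sum-χ₁ Vec.[]              = refl
sum-χ₁ {suc n} (b Vec.∷ p)
  rewrite tabulate-suc n | sum₁-map (χ₁ (b Vec.∷ p)) suc (allFin n) | sum-χ₁ p with b
... | outside = refl
... | inside  = refl

sum-χ₂ : ∀ (p : Subset n) → sum₂ (χ₂ p) (allFin n) ≡ ∣ p ∣ C 2
sum-χ₂ Vec.[]              = refl
sum-χ₂ {suc n} (b Vec.∷ p)
  rewrite tabulate-suc n | sum₁-* (bit b) (χ₁ (b Vec.∷ p)) (map suc (allFin n))
        | sum₁-map (χ₁ (b Vec.∷ p)) suc (allFin n) | sum₂-map (χ₂ (b Vec.∷ p)) suc (allFin n)
        | sum-χ₁ p | sum-χ₂ p with b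
... | outside = refl
... | inside  rewrite *-identityˡ ∣ p ∣ = sym (suc-C₂ ∣ p ∣)

-- Splitting off the first point is Pascal's rule. For a 3-subset the value is C(3,3) = 1, so each
-- member is counted once.
sum-χ₃ : ∀ (p : Subset n) → sum₃ (χ₃ p) (allFin n) ≡ ∣ p ∣ C 3
sum-χ₃ Vec.[]              = refl
sum-χ₃ {suc n} (b Vec.∷ p)
  rewrite tabulate-suc n | sum₂-* (bit b) (χ₂ (b Vec.∷ p)) (map suc (allFin n))
        | sum₂-map (χ₂ (b Vec.∷ p)) suc (allFin n) | sum₃-map (χ₃ (b Vec.∷ p)) suc (allFin n)
        | sum-χ₂ p | sum-χ₃ p with b
... | outside = refl
... | inside  rewrite *-identityˡ (∣ p ∣ C 2) = nCk+nC[k+1]≡[n+1]C[k+1] ∣ p ∣ 2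

χ₁≢0⇒∈ : ∀ (p : Subset n) i → χ₁ p i ≢ 0 → i ∈ˢ p
χ₁≢0⇒∈ p i χ≢0 with Vec.lookup p i in eq
... | inside  = lookup⇒[]= i p eq
... | outside = contradiction refl χ≢0

∈⇒χ₁≡1 : ∀ (p : Subset n) {i} → i ∈ˢ p → χ₁ p i ≡ 1
∈⇒χ₁≡1 p i∈p rewrite []=⇒lookup i∈p = refl

∉⇒χ₁≡0 : ∀ (p : Subset n) {i} → i ∉ˢ p → χ₁ p i ≡ 0
∉⇒χ₁≡0 p {i} i∉p = ≡0-by-contradiction (i∉p ∘ χ₁≢0⇒∈ p i)

χ₁≤1 : ∀ (p : Subset n) i → χ₁ p i ≤ 1
χ₁≤1 p i with Vec.lookup p i
... | inside  = s≤s z≤n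
... | outside = z≤n

χ₃≤1 : ∀ (p : Subset n) i j k → χ₃ p i j k ≤ 1
χ₃≤1 p i j k = *-mono-≤ (χ₁≤1 p i) (*-mono-≤ (χ₁≤1 p j) (χ₁≤1 p k))

χ₃≢0⇒⊆ : ∀ (p : Subset n) i j k → χ₃ p i j k ≢ 0 → All (_∈ˢ p) (i ∷ j ∷ k ∷ [])
χ₃≢0⇒⊆ p i j k χ≢0 =
  χ₁≢0⇒∈ p i (λ eq → χ≢0 (cong (_* χ₂ p j k) eq)) ∷
  χ₁≢0⇒∈ p j (λ eq → χ≢0 (≡-trans (cong (λ m → χ₁ p i * (m * χ₁ p k)) eq) (*-zeroʳ (χ₁ p i)))) ∷
  χ₁≢0⇒∈ p k (λ eq → χ≢0 (≡-trans (cong (λ m → χ₁ p i * (χ₁ p j * m)) eq)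
    (≡-trans (cong (χ₁ p i *_) (*-zeroʳ (χ₁ p j))) (*-zeroʳ (χ₁ p i))))) ∷ []

⊆⇒χ₃≡1 : ∀ (p : Subset n) {i j k} → All (_∈ˢ p) (i ∷ j ∷ k ∷ []) → χ₃ p i j k ≡ 1
⊆⇒χ₃≡1 p (i∈p ∷ j∈p ∷ k∈p ∷ []) rewrite ∈⇒χ₁≡1 p i∈p | ∈⇒χ₁≡1 p j∈p | ∈⇒χ₁≡1 p k∈p = refl

sum-χ₁-⊆ : ∀ (p : Subset n) {is} → All (_∈ˢ p) is → sum₁ (χ₁ p) is ≡ length is
sum-χ₁-⊆ p []           = refl
sum-χ₁-⊆ p (i∈p ∷ is⊆p) = cong₂ _+_ (∈⇒χ₁≡1 p i∈p) (sum-χ₁-⊆ p is⊆p)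

-- A further element `z` would make the indicator sum over `z ∷ is` exceed the cardinality of `p`.
exhaust : ∀ (p : Subset n) {is} → Unique is → All (_∈ˢ p) is → length is ≡ ∣ p ∣ → ∀ {z} → z ∈ˢ p → z ∈ is
exhaust {n} p {is} uis is⊆p |is| {z} z∈p with _∈?_ _≟ᶠ_ z is
... | yes z∈is = z∈is
... | no  z∉is = contradiction (begin-strict
  ∣ p ∣                      <⟨ s≤s (≤-reflexive (sym |is|)) ⟩
  length (z ∷ is)            ≡⟨ sum-χ₁-⊆ p (z∈p ∷ is⊆p) ⟨
  sum₁ (χ₁ p) (z ∷ is)       ≤⟨ m≤m+n _ (sum₁ (χ₁ p) js) ⟩
  sum₁ (χ₁ p) (z ∷ is) + sum₁ (χ₁ p) js ≡⟨ sum₁-++ (χ₁ p) (z ∷ is) js ⟨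
  sum₁ (χ₁ p) (z ∷ is ++ js) ≡⟨ sum₁-↭ (χ₁ p) q ⟨
  sum₁ (χ₁ p) (allFin n)     ≡⟨ sum-χ₁ p ⟩
  ∣ p ∣                      ∎) (<-irrefl refl)
  where
  open ≤-Reasoning
  found = cover (Allₚ.¬Any⇒All¬ is z∉is ∷ uis)
  js = proj₁ found
  q  = proj₂ found

∣∣≡length : ∀ (p : Subset n) {is} → Unique is → All (_∈ˢ p) is → (∀ {z} → z ∈ˢ p → z ∈ is) → ∣ p ∣ ≡ length is
∣∣≡length {n} p {is} uis is⊆p p⊆is = begin
  ∣ p ∣                    ≡⟨ sum-χ₁ p ⟨
  sum₁ (χ₁ p) (allFin n)   ≡⟨ sum₁-↭ (χ₁ p) q ⟩
  sum₁ (χ₁ p) (is ++ js)   ≡⟨ sum₁-++ (χ₁ p) is js ⟩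
  sum₁ (χ₁ p) is + sum₁ (χ₁ p) js ≡⟨ cong₂ _+_ (sum-χ₁-⊆ p is⊆p) (sum₁≡0 (χ₁ p) js outside-p) ⟩
  length is + 0            ≡⟨ +-identityʳ _ ⟩
  length is                ∎
  where
  open ≡-Reasoning
  found = cover uis
  js = proj₁ found
  q  = proj₂ found
  outside-p : ∀ {z zs} → js ↭ z ∷ zs → χ₁ p z ≡ 0
  outside-p r = ∉⇒χ₁≡0 p λ z∈p → proj₂ (proj₂ (Unique-++⁻ is
    (Unique-resp-↭ (trans q (++⁺ˡ is r)) (Uniqueₚ.allFin⁺ n)))) (p⊆is z∈p , here refl)

-- General position sets of the Kneser graph

Triple : ℕ → Set
Triple n = SubsetOfSize n 3

infix 4 _∈³_ _∥_

_∈³_ : Fin n → Triple n → Set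
i ∈³ (p , _) = i ∈ˢ p

_∥_ : Triple n → Triple n → Set
(p , _) ∥ (q , _) = Empty (p ∩ q)

∥-sym : ∀ (s t : Triple n) → s ∥ t → t ∥ s
∥-sym (p , _) (q , _) = subst Empty (∩-comm p q)

SubsetOfSize-≡ : ∀ {k} {s t : SubsetOfSize n k} → proj₁ s ≡ proj₁ t → s ≡ t
SubsetOfSize-≡ {s = p , eq} {.p , eq₁} refl = cong (p ,_) (≡-irrelevant eq eq₁)

elements⇒ : ∀ (s : Triple n) {i j k} → Unique (i ∷ j ∷ k ∷ []) → All (_∈³ s) (i ∷ j ∷ k ∷ []) →
            ∀ {z} → z ∈³ s → z ∈ i ∷ j ∷ k ∷ []
elements⇒ (p , |p|) u ijk∈s = exhaust p u ijk∈s (sym |p|)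

same-elements : ∀ (s t : Triple n) {i j k} → Unique (i ∷ j ∷ k ∷ []) →
                All (_∈³ s) (i ∷ j ∷ k ∷ []) → All (_∈³ t) (i ∷ j ∷ k ∷ []) → s ≡ t
same-elements s t u ijk∈s ijk∈t = SubsetOfSize-≡ (⊆-antisym
  (λ z∈s → All.lookup ijk∈t (elements⇒ s u ijk∈s z∈s))
  (λ z∈t → All.lookup ijk∈s (elements⇒ t u ijk∈t z∈t)))

elements : ∀ (s : Triple n) → ∃[ i ] ∃[ j ] ∃[ k ] Unique (i ∷ j ∷ k ∷ []) × All (_∈³ s) (i ∷ j ∷ k ∷ [])
elements {n} (p , |p|)
  -- The sum of `χ₃ p` is C(3,3) = 1, hence some term is nonzero.
  with i , j , k , js , q , ijk ← pick₃ (χ₃ p) (allFin n) (λ s≡0 → contradiction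
    (≡-trans (sym s≡0) (≡-trans (sum-χ₃ p) (cong (_C 3) |p|))) λ ()) =
  i , j , k , Uniqueₚ.take⁺ 3 (Unique-resp-↭ q (Uniqueₚ.allFin⁺ n)) , χ₃≢0⇒⊆ p i j k ijk

elements-disjoint : ∀ (s t : Triple n) {i j k l m o} → Unique (i ∷ j ∷ k ∷ l ∷ m ∷ o ∷ []) →
                    All (_∈³ s) (i ∷ j ∷ k ∷ []) → All (_∈³ t) (l ∷ m ∷ o ∷ []) → s ∥ t
elements-disjoint (p , |p|) (q , |q|) {i} {j} {k} u ijk∈s lmo∈t (z , z∈p∩q)
  with z∈p , z∈q ← x∈p∩q⁻ p q z∈p∩q
  with u₁ , u₂ , d ← Unique-++⁻ (i ∷ j ∷ k ∷ []) u =
  d (elements⇒ (p , |p|) u₁ ijk∈s z∈p , elements⇒ (q , |q|) u₂ lmo∈t z∈q)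

triple : ∀ {i j k : Fin n} → Unique (i ∷ j ∷ k ∷ []) → Σ[ s ∈ Triple n ] All (_∈³ s) (i ∷ j ∷ k ∷ [])
triple {i = i} {j} {k} u = (p , ∣∣≡length p u ijk∈p p⊆ijk) , ijk∈p
  where
  p = ⁅ i ⁆ ∪ (⁅ j ⁆ ∪ ⁅ k ⁆)
  ijk∈p : All (_∈ˢ p) (i ∷ j ∷ k ∷ [])
  ijk∈p = x∈p∪q⁺ (inj₁ (x∈⁅x⁆ i)) ∷ x∈p∪q⁺ (inj₂ (x∈p∪q⁺ (inj₁ (x∈⁅x⁆ j)))) ∷
          x∈p∪q⁺ (inj₂ (x∈p∪q⁺ (inj₂ (x∈⁅x⁆ k)))) ∷ []
  p⊆ijk : ∀ {z} → z ∈ˢ p → z ∈ i ∷ j ∷ k ∷ []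
  p⊆ijk z∈p with x∈p∪q⁻ ⁅ i ⁆ _ z∈p
  ... | inj₁ z∈i = here (x∈⁅y⁆⇒x≡y i z∈i)
  ... | inj₂ z∈jk with x∈p∪q⁻ ⁅ j ⁆ _ z∈jk
  ...   | inj₁ z∈j = there (here (x∈⁅y⁆⇒x≡y j z∈j))
  ...   | inj₂ z∈k = there (there (here (x∈⁅y⁆⇒x≡y k z∈k)))

-- Vertex sets as triple systems

module _ (S : List (Triple n)) (uS : Unique S) where

  private
    member : Triple n → Fin n → Fin n → Fin n → ℕ
    member (p , _) = χ₃ p

    g : Fin n → Fin n → Fin n → ℕ
    g i j k = sum₁ (λ s → member s i j k) S

  g≢0⇒∈ : ∀ {i j k} → g i j k ≢ 0 → ∃[ s ] s ∈ S × All (_∈³ s) (i ∷ j ∷ k ∷ [])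
  g≢0⇒∈ {i} {j} {k} ijk with s , ss , q , χ ← pick₁ _ S ijk =
    s , ∈-resp-↭ (↭-sym q) (here refl) , χ₃≢0⇒⊆ (proj₁ s) i j k χ

  ∈⇒g≢0 : ∀ {s i j k} → s ∈ S → All (_∈³ s) (i ∷ j ∷ k ∷ []) → g i j k ≢ 0
  ∈⇒g≢0 {s} {i} {j} {k} s∈S ijk∈s ijk≡0 with as , bs , eq ← ∈-∃++ s∈S = contradiction
    (≡-trans (sym (⊆⇒χ₃≡1 (proj₁ s) ijk∈s)) (m+n≡0⇒m≡0 (member s i j k)
      (≡-trans (sym (sum₁-↭ (λ s → member s i j k) (subst (_↭ s ∷ as ++ bs) (sym eq) (shift s as bs)))) ijk≡0))) λ ()

  -- The value counts the members containing the given points. Three distinct points determine a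
  -- 3-set and `S` has no repetitions, whence the bound 1.
  system : TripleSystem (Fin n)
  system .f = g
  system .f-swap₁ i j k = sum₁-cong (λ (p , _) → swap-factors (χ₁ p i) (χ₁ p j) (χ₁ p k)) S
    where
    swap-factors : ∀ a b c → a * (b * c) ≡ b * (a * c)
    swap-factors = solve-∀
  system .f-swap₂ i j k = sum₁-cong (λ (p , _) → cong (χ₁ p i *_) (*-comm (χ₁ p j) (χ₁ p k))) S
  system .f≤1 {i} {j} {k} u = ≢0-or-≡0 (g i j k) nonempty λ ijk≡0 → ≤-trans (≤0 ijk≡0) z≤n
    where
    open ≤-Reasoning
    nonempty : g i j k ≢ 0 → g i j k ≤ 1
    nonempty ijk with s , ss , q , χ ← pick₁ (λ s → member s i j k) S ijk = begin
      g i j k                                         ≡⟨ sum₁-↭ (λ s → member s i j k) q ⟩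
      member s i j k + sum₁ (λ s → member s i j k) ss ≤⟨ +-mono-≤ (χ₃≤1 (proj₁ s) i j k) (≤0 (sum₁≡0 _ ss only)) ⟩
      1                                               ∎
      where
      only : ∀ {t ts} → ss ↭ t ∷ ts → member t i j k ≡ 0
      only {t} r with (s≢t ∷ _) ∷ _ ← Unique-resp-↭ (trans q (prep s r)) uS = ≡0-by-contradiction λ χ′ →
        s≢t (same-elements s t u (χ₃≢0⇒⊆ (proj₁ s) i j k χ) (χ₃≢0⇒⊆ (proj₁ t) i j k χ′))

  -- After interchanging the sums, each member contributes C(3,3) = 1.
  size-system : size system (allFin n) ≡ length S
  size-system = ≡-trans (sum₃-sum₁ member S (allFin n)) (count S)
    where
    count : ∀ ss → sum₁ (λ s → sum₃ (member s) (allFin n)) ss ≡ length ss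
    count []               = refl
    count ((p , |p|) ∷ ss) = cong₂ _+_ (≡-trans (sum-χ₃ p) (cong (_C 3) |p|)) (count ss)

  intersecting-system : (∀ {s t} → s ∈ S → t ∈ S → ¬ (s ∥ t)) → Intersecting system
  intersecting-system meet u ijk = ≡0-by-contradiction λ lmo →
    let s , s∈S , ijk∈s = g≢0⇒∈ ijk
        t , t∈S , lmo∈t = g≢0⇒∈ lmo in
    meet s∈S t∈S (elements-disjoint s t u ijk∈s lmo∈t)

-- Distances in the Kneser graph and general position

module _ {n : ℕ} where

  private
    K : Graph
    K = Kneser n 3

  adjacent-distance : ∀ {s t : Triple n} → s ≢ t → s ∥ t → Distance K s t 1
  adjacent-distance s≢t s∥t = (cons s∥t nil , (s≢t ∷ []) ∷ [] ∷ []) , λ where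
    zero    (nil , _) → contradiction refl s≢t
    (suc l) _         → s≤s z≤n

  meeting-walk : ∀ {s t : Triple n} {z l} → s ≢ t → z ∈³ s → z ∈³ t → Walk K s t l → 2 ≤ l
  meeting-walk s≢t z∈s z∈t nil                   = contradiction refl s≢t
  meeting-walk s≢t z∈s z∈t (cons s∥t nil)        = contradiction (_ , x∈p∩q⁺ (z∈s , z∈t)) s∥t
  meeting-walk s≢t z∈s z∈t (cons _ (cons _ _))   = s≤s (s≤s z≤n)

  meeting-distance : ∀ {s t u : Triple n} {z} → s ≢ t → z ∈³ s → z ∈³ t → s ≢ u → t ≢ u → s ∥ u → u ∥ t →
                     Distance K s t 2
  meeting-distance s≢t z∈s z∈t s≢u t≢u s∥u u∥t =
    (cons s∥u (cons u∥t nil) , (s≢u ∷ s≢t ∷ []) ∷ ((t≢u ∘ sym) ∷ []) ∷ [] ∷ []) ,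
    λ _ (w , _) → meeting-walk s≢t z∈s z∈t w

  disjoint⇒≢ : ∀ (s t : Triple n) → s ∥ t → s ≢ t
  disjoint⇒≢ s _ s∥s refl with i , _ , _ , _ , i∈s ∷ _ ← elements s = s∥s (i , x∈p∩q⁺ (i∈s , i∈s))

  -- Meeting triples with a common neighbour have distance 2 = 1 + 1, so `u` lies on a geodesic from
  -- `s` to `t`.
  no-path : ∀ {S} → GeneralPosition K S → ∀ {s t u z} → s ∈ S → t ∈ S → u ∈ S →
            s ≢ t → z ∈³ s → z ∈³ t → s ∥ u → t ∥ u → ⊥
  no-path gp {s} {t} {u} s∈S t∈S u∈S s≢t z∈s z∈t s∥u t∥u =
    gp s∈S t∈S u∈S s≢t (disjoint⇒≢ s u s∥u) (disjoint⇒≢ t u t∥u)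
      (meeting-distance s≢t z∈s z∈t (disjoint⇒≢ s u s∥u) (disjoint⇒≢ t u t∥u) s∥u u∥t)
      (adjacent-distance (disjoint⇒≢ s u s∥u) s∥u) (adjacent-distance (disjoint⇒≢ u t u∥t) u∥t) refl
    where
    u∥t : u ∥ t
    u∥t = ∥-sym t u t∥u

  ∉⇒≢ : ∀ {s t : Triple n} {i j l k} → Unique (i ∷ j ∷ l ∷ []) → All (_∈³ t) (i ∷ j ∷ l ∷ []) →
        k ∈³ s → All (k ≢_) (i ∷ j ∷ l ∷ []) → s ≢ t
  ∉⇒≢ {t = t} u ijl∈t k∈s k∉ refl = All.lookup k∉ (elements⇒ t u ijl∈t k∈s) refl

  pathFree-system : ∀ {S} (uS : Unique S) → GeneralPosition K S → PathFree (system S uS)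
  pathFree-system {S} uS gp .meeting₂ v mno ijk = ≡0-by-contradiction λ ijl →
    let s , s∈S , ijk∈s = g≢0⇒∈ S uS ijk
        t , t∈S , ijl∈t = g≢0⇒∈ S uS ijl
        u , u∈S , mno∈u = g≢0⇒∈ S uS mno in
    no-path gp s∈S t∈S u∈S
      -- The point `k` lies in `s` but not in `t`.
      (∉⇒≢ (select v (0 ∷ 1 ∷ 3 ∷ [])) ijl∈t (All.lookup ijk∈s (there (there (here refl))))
        (AllPairs.head (select v (2 ∷ 0 ∷ 1 ∷ 3 ∷ []))))
      (All.head ijk∈s) (All.head ijl∈t)
      (elements-disjoint s u (select v (0 ∷ 1 ∷ 2 ∷ 4 ∷ 5 ∷ 6 ∷ [])) ijk∈s mno∈u)
      (elements-disjoint t u (select v (0 ∷ 1 ∷ 3 ∷ 4 ∷ 5 ∷ 6 ∷ [])) ijl∈t mno∈u)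
  pathFree-system {S} uS gp .meeting₁ v nop ijk = ≡0-by-contradiction λ ilm →
    let s , s∈S , ijk∈s = g≢0⇒∈ S uS ijk
        t , t∈S , ilm∈t = g≢0⇒∈ S uS ilm
        u , u∈S , nop∈u = g≢0⇒∈ S uS nop in
    no-path gp s∈S t∈S u∈S
      (∉⇒≢ (select v (0 ∷ 3 ∷ 4 ∷ [])) ilm∈t (All.lookup ijk∈s (there (there (here refl))))
        (AllPairs.head (select v (2 ∷ 0 ∷ 3 ∷ 4 ∷ []))))
      (All.head ijk∈s) (All.head ilm∈t)
      (elements-disjoint s u (select v (0 ∷ 1 ∷ 2 ∷ 5 ∷ 6 ∷ 7 ∷ [])) ijk∈s nop∈u)
      (elements-disjoint t u (select v (0 ∷ 3 ∷ 4 ∷ 5 ∷ 6 ∷ 7 ∷ [])) ilm∈t nop∈u)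

exhaust-all : ∀ {is : List (Fin n)} → Unique is → length is ≡ n → ∀ z → z ∈ is
exhaust-all {is = is} u |is| z with js , q ← cover u with ∈-++⁻ is (∈-resp-↭ q (∈-allFin z))
... | inj₁ z∈is = z∈is
... | inj₂ z∈js = contradiction (≡-trans (cover-length {is = is} q) (≡-trans (sym |is|) (sym (+-identityʳ _))))
  (λ eq → <-irrefl (sym (+-cancelˡ-≡ (length is) _ 0 eq)) (∈-length z∈js))

-- In K(7,3) a geodesic from {i,j,l} to {l,m,o} passes through {m,o,p} and then {i,j,k}.
spread : ∀ {S} (uS : Unique S) → GeneralPosition (Kneser n 3) S →
         ∀ {i j k l m o p} → Unique (i ∷ j ∷ k ∷ l ∷ m ∷ o ∷ p ∷ []) →
         (∀ z → z ∈ i ∷ j ∷ k ∷ l ∷ m ∷ o ∷ p ∷ []) →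
         f (system S uS) i j k ≢ 0 → f (system S uS) l m o ≢ 0 → f (system S uS) i j l ≡ 0
spread {n} {S} uS gp {i} {j} {k} {l} {m} {o} {p} v all ijk lmo = ≡0-by-contradiction λ ijl →
  let s , s∈S , ijk∈s = g≢0⇒∈ S uS ijk
      t , t∈S , lmo∈t = g≢0⇒∈ S uS lmo
      r , r∈S , ijl∈r = g≢0⇒∈ S uS ijl
      w , mop∈w       = triple (select v (4 ∷ 5 ∷ 6 ∷ [])) in
  conflict s t r w s∈S t∈S r∈S ijk∈s lmo∈t ijl∈r mop∈w
  where
  conflict : ∀ s t r w → s ∈ S → t ∈ S → r ∈ S → All (_∈³ s) (i ∷ j ∷ k ∷ []) → All (_∈³ t) (l ∷ m ∷ o ∷ []) →
             All (_∈³ r) (i ∷ j ∷ l ∷ []) → All (_∈³ w) (m ∷ o ∷ p ∷ []) → ⊥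
  conflict s t r w s∈S t∈S r∈S ijk∈s lmo∈t ijl∈r mop∈w =
    gp r∈S t∈S s∈S r≢t r≢s (disjoint⇒≢ s t s∥t ∘ sym) r–t
      (meeting-distance r≢s (All.head ijl∈r) (All.head ijk∈s) r≢w (disjoint⇒≢ w s w∥s ∘ sym) r∥w w∥s)
      (adjacent-distance (disjoint⇒≢ s t s∥t) s∥t) refl
    where
    s∥t : s ∥ t
    s∥t = elements-disjoint s t (select v (0 ∷ 1 ∷ 2 ∷ 3 ∷ 4 ∷ 5 ∷ [])) ijk∈s lmo∈t
    w∥s : w ∥ s
    w∥s = elements-disjoint w s (select v (4 ∷ 5 ∷ 6 ∷ 0 ∷ 1 ∷ 2 ∷ [])) mop∈w ijk∈s
    r∥w : r ∥ w
    r∥w = elements-disjoint r w (select v (0 ∷ 1 ∷ 3 ∷ 4 ∷ 5 ∷ 6 ∷ [])) ijl∈r mop∈w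
    r≢w : r ≢ w
    r≢w = disjoint⇒≢ r w r∥w
    r≢s : r ≢ s
    r≢s = ∉⇒≢ (select v (0 ∷ 1 ∷ 2 ∷ [])) ijk∈s (All.lookup ijl∈r (there (there (here refl))))
      (AllPairs.head (select v (3 ∷ 0 ∷ 1 ∷ 2 ∷ [])))
    r≢t : r ≢ t
    r≢t = ∉⇒≢ (select v (3 ∷ 4 ∷ 5 ∷ [])) lmo∈t (All.head ijl∈r) (AllPairs.head (select v (0 ∷ 3 ∷ 4 ∷ 5 ∷ [])))
    w≢t : w ≢ t
    w≢t = ∉⇒≢ (select v (3 ∷ 4 ∷ 5 ∷ [])) lmo∈t (All.lookup mop∈w (there (there (here refl))))
      (AllPairs.head (select v (6 ∷ 3 ∷ 4 ∷ 5 ∷ [])))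
    -- The union of `r` and `t` has five of the seven points; the two others, `k` and `p`, cannot
    -- hold a triple.
    no-common-neighbour : ∀ x → r ∥ x → x ∥ t → ⊥
    no-common-neighbour x r∥x x∥t
      with a , b , c , u , abc∈x ← elements x =
      contradiction (↭-length (proj₂ (extend u (All.map inside-kp abc∈x)))) λ ()
      where
      inside-kp : ∀ {z} → z ∈³ x → z ∈ k ∷ p ∷ []
      inside-kp {z} z∈x with all z
      ... | here refl                                         = contradiction (z , x∈p∩q⁺ (All.head ijl∈r , z∈x)) r∥x
      ... | there (here refl)                                 = contradiction (z , x∈p∩q⁺ (All.lookup ijl∈r (there (here refl)) , z∈x)) r∥x
      ... | there (there (here refl))                         = here refl
      ... | there (there (there (here refl)))                 = contradiction (z , x∈p∩q⁺ (z∈x , All.head lmo∈t)) x∥t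
      ... | there (there (there (there (here refl))))         = contradiction (z , x∈p∩q⁺ (z∈x , All.lookup lmo∈t (there (here refl)))) x∥t
      ... | there (there (there (there (there (here refl))))) = contradiction (z , x∈p∩q⁺ (z∈x , All.lookup lmo∈t (there (there (here refl))))) x∥t
      ... | there (there (there (there (there (there (here refl)))))) = there (here refl)
    r–t : Distance (Kneser n 3) r t 3
    r–t = (cons r∥w (cons w∥s (cons s∥t nil)) ,
           (r≢w ∷ r≢s ∷ r≢t ∷ []) ∷ (disjoint⇒≢ w s w∥s ∷ w≢t ∷ []) ∷ (disjoint⇒≢ s t s∥t ∷ []) ∷ [] ∷ []) ,
          λ where
            _ (nil , _) → contradiction refl r≢t
            _ (cons r∥t nil , _) → contradiction (l , x∈p∩q⁺ (All.lookup ijl∈r (there (there (here refl))) , All.head lmo∈t)) r∥t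
            _ (cons {v = x} r∥x (cons x∥t nil) , _) → contradiction x∥t (no-common-neighbour x r∥x)
            _ (cons _ (cons _ (cons _ _)) , _) → s≤s (s≤s (s≤s z≤n))

upper-bound : ∀ m → n ≡ 7 + m → ∀ {S} → Unique S → GeneralPosition (Kneser n 3) S → length S ≤ (6 + m) C 2
upper-bound {n} m n≡7+m {S} uS gp with any? (λ s → any? (λ t → ¬? (nonempty? (proj₁ s ∩ proj₁ t))) S) S
... | no  none = begin
  length S           ≡⟨ size-system S uS ⟨
  size F (allFin n)  ≤⟨ ekr F (intersecting-system S uS λ s∈S t∈S s∥t → none (lose s∈S (lose t∈S s∥t))) m
                          (Uniqueₚ.allFin⁺ n) (≡-trans (length-tabulate _) n≡7+m) ⟩
  (6 + m) C 2        ∎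
  where
  open ≤-Reasoning
  F : TripleSystem (Fin n)
  F = system S uS
... | yes some
  with s , s∈S , some-t ← find some
  with t , t∈S , s∥t ← find some-t
  with i , j , k , us , ijk∈s ← elements s
  with a , b , c , ut , abc∈t ← elements t
  with R , q ← cover (Uniqueₚ.++⁺ us ut λ (z∈s , z∈t) → s∥t (_ , x∈p∩q⁺ (All.lookup ijk∈s z∈s , All.lookup abc∈t z∈t))) = begin
  length S                            ≡⟨ size-system S uS ⟨
  size F (allFin n)                   ≡⟨ size-↭ F q ⟩
  size F (i ∷ j ∷ k ∷ a ∷ b ∷ c ∷ R)  ≤⟨ bound m R n≡7+m (Unique-resp-↭ q (Uniqueₚ.allFin⁺ n))
                                           (+-cancelˡ-≡ 6 _ _ (≡-trans (cover-length {is = i ∷ j ∷ k ∷ a ∷ b ∷ c ∷ []} q) n≡7+m)) ⟩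
  (6 + m) C 2                         ∎
  where
  open ≤-Reasoning
  F : TripleSystem (Fin n)
  F = system S uS
  ijk : f F i j k ≢ 0
  ijk = ∈⇒g≢0 S uS s∈S ijk∈s
  abc : f F a b c ≢ 0
  abc = ∈⇒g≢0 S uS t∈S abc∈t
  bound : ∀ m R → n ≡ 7 + m → Unique (i ∷ j ∷ k ∷ a ∷ b ∷ c ∷ R) → length R ≡ 1 + m →
          size F (i ∷ j ∷ k ∷ a ∷ b ∷ c ∷ R) ≤ (6 + m) C 2
  -- At n = 7 any seven distinct points are all points, as the distance-three argument of `spread`
  -- requires.
  bound zero    (_ ∷ []) n≡7 u _   =
    size₇ F (pathFree-system uS gp) u ijk abc λ v → spread uS gp v (exhaust-all v (sym n≡7))
  bound (suc m) R        _   u |R| =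
    subst (λ l → size F (i ∷ j ∷ k ∷ a ∷ b ∷ c ∷ R) ≤ l C 2) (sym (+-suc 6 m))
      (nonintersecting F (pathFree-system uS gp) m u ijk abc |R|)

-- Stars and the lower bound

elements-at : ∀ (s : Triple n) {z} → z ∈³ s → ∃[ a ] ∃[ b ] Unique (z ∷ a ∷ b ∷ []) × All (_∈³ s) (z ∷ a ∷ b ∷ [])
elements-at s z∈s with i , j , k , u , ijk∈s@(i∈s ∷ j∈s ∷ k∈s ∷ []) ← elements s with elements⇒ s u ijk∈s z∈s
... | here refl                 = j , k , u , ijk∈s
... | there (here refl)         = i , k , select u (1 ∷ 0 ∷ 2 ∷ []) , j∈s ∷ i∈s ∷ k∈s ∷ []
... | there (there (here refl)) = i , j , select u (2 ∷ 0 ∷ 1 ∷ []) , k∈s ∷ i∈s ∷ j∈s ∷ []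

fresh : ∀ {is : List (Fin n)} k → Unique is → length is + k ≤ n →
        ∃[ js ] length js ≡ k × Unique (is ++ js)
fresh {n} {is} k u |is|+k≤n with js , q ← cover u =
  take k js ,
  ≡-trans (length-take k js) (m≤n⇒m⊓n≡m (+-cancelˡ-≤ (length is) _ _ (≤-trans |is|+k≤n (≤-reflexive (sym (cover-length {is = is} q)))))) ,
  take-suffix is (Unique-resp-↭ q (Uniqueₚ.allFin⁺ n))
  where
  take-suffix : ∀ is {js} → Unique (is ++ js) → Unique (is ++ take k js)
  take-suffix is v with v₁ , v₂ , d ← Unique-++⁻ is v =
    Uniqueₚ.++⁺ v₁ (Uniqueₚ.take⁺ k v₂) λ (z∈is , z∈js) → d (z∈is , ∈-take z∈js)
    where
    ∈-take : ∀ {k z} {js : List (Fin n)} → z ∈ take k js → z ∈ js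
    ∈-take {suc k} {js = _ ∷ _} (here eq)  = here eq
    ∈-take {suc k} {js = _ ∷ _} (there z∈) = there (∈-take z∈)

ShortPath : (s t : Triple n) → Set
ShortPath {n} s t = ∃[ l ] Path (Kneser n 3) s t l × l ≤ 3

module _ (7≤n : 7 ≤ n) where

  path-meeting₂ : ∀ {s t : Triple n} {z a b c} → s ≢ t → Unique (z ∷ a ∷ b ∷ []) → Unique (z ∷ a ∷ c ∷ []) →
                  All (_∈³ s) (z ∷ a ∷ b ∷ []) → All (_∈³ t) (z ∷ a ∷ c ∷ []) → ShortPath s t
  path-meeting₂ {s} {t} s≢t u@((z≢a ∷ z≢b ∷ []) ∷ (a≢b ∷ []) ∷ _) ((_ ∷ z≢c ∷ []) ∷ (a≢c ∷ []) ∷ _) zab∈s zac∈t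
    -- The union of `s` and `t` has four points, so seven points leave three for a common neighbour.
    with x ∷ y ∷ o ∷ [] , refl , w ← fresh 3 ((z≢a ∷ z≢b ∷ z≢c ∷ []) ∷ (a≢b ∷ a≢c ∷ []) ∷
           ((λ { refl → s≢t (same-elements s t u zab∈s zac∈t) }) ∷ []) ∷ [] ∷ []) 7≤n
    with r , xyo∈r ← triple (select w (4 ∷ 5 ∷ 6 ∷ []))
    with s∥r ← elements-disjoint s r (select w (0 ∷ 1 ∷ 2 ∷ 4 ∷ 5 ∷ 6 ∷ [])) zab∈s xyo∈r
    with r∥t ← elements-disjoint r t (select w (4 ∷ 5 ∷ 6 ∷ 0 ∷ 1 ∷ 3 ∷ [])) xyo∈r zac∈t =
    2 , proj₁ (meeting-distance s≢t (All.head zab∈s) (All.head zac∈t)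
          (disjoint⇒≢ s r s∥r) (disjoint⇒≢ r t r∥t ∘ sym) s∥r r∥t) , s≤s (s≤s z≤n)

  -- Seven points may leave only two outside the union of `s` and `t`, too few for a common
  -- neighbour. Splitting them gives the path through {c, d, x} and {a, b, y}.
  path-meeting₁ : ∀ {s t : Triple n} {z a b c d} → s ≢ t → Unique (z ∷ a ∷ b ∷ c ∷ d ∷ []) →
                  All (_∈³ s) (z ∷ a ∷ b ∷ []) → All (_∈³ t) (z ∷ c ∷ d ∷ []) → ShortPath s t
  path-meeting₁ {s} {t} s≢t u zab∈s zcd∈t
    with x ∷ y ∷ [] , refl , w ← fresh 2 u 7≤n
    with r , cdx∈r ← triple (select w (3 ∷ 4 ∷ 5 ∷ []))
    with q , aby∈q ← triple (select w (1 ∷ 2 ∷ 6 ∷ []))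
    with s∥r ← elements-disjoint s r (select w (0 ∷ 1 ∷ 2 ∷ 3 ∷ 4 ∷ 5 ∷ [])) zab∈s cdx∈r
    with r∥q ← elements-disjoint r q (select w (3 ∷ 4 ∷ 5 ∷ 1 ∷ 2 ∷ 6 ∷ [])) cdx∈r aby∈q
    with q∥t ← elements-disjoint q t (select w (1 ∷ 2 ∷ 6 ∷ 0 ∷ 3 ∷ 4 ∷ [])) aby∈q zcd∈t =
    3 , (cons s∥r (cons r∥q (cons q∥t nil)) ,
         (disjoint⇒≢ s r s∥r ∷ s≢q ∷ s≢t ∷ []) ∷ (disjoint⇒≢ r q r∥q ∷ r≢t ∷ []) ∷ (disjoint⇒≢ q t q∥t ∷ []) ∷ [] ∷ []) ,
    ≤-refl
    where
    s≢q = ∉⇒≢ (select w (1 ∷ 2 ∷ 6 ∷ [])) aby∈q (All.head zab∈s) (AllPairs.head (select w (0 ∷ 1 ∷ 2 ∷ 6 ∷ [])))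
    r≢t = ∉⇒≢ (select w (0 ∷ 3 ∷ 4 ∷ [])) zcd∈t (All.lookup cdx∈r (there (there (here refl))))
            (AllPairs.head (select w (5 ∷ 0 ∷ 3 ∷ 4 ∷ [])))

  short-path : ∀ {s t : Triple n} {z} → s ≢ t → z ∈³ s → z ∈³ t → ShortPath s t
  short-path {s} {t} {z} s≢t z∈s z∈t
    with a , b , u@((z≢a ∷ z≢b ∷ []) ∷ (a≢b ∷ []) ∷ _) , zab∈s@(_ ∷ a∈s ∷ b∈s ∷ []) ← elements-at s z∈s
    with c , d , v@((z≢c ∷ z≢d ∷ []) ∷ (c≢d ∷ []) ∷ _) , zcd∈t@(_ ∷ c∈t ∷ d∈t ∷ []) ← elements-at t z∈t
    with a ≟ᶠ c | a ≟ᶠ d | b ≟ᶠ c | b ≟ᶠ d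
  ... | yes refl | _        | _        | _        = path-meeting₂ s≢t u v zab∈s zcd∈t
  ... | no _     | yes refl | _        | _        =
    path-meeting₂ s≢t u (select v (0 ∷ 2 ∷ 1 ∷ [])) zab∈s (z∈t ∷ d∈t ∷ c∈t ∷ [])
  ... | no _     | no _     | yes refl | _        =
    path-meeting₂ s≢t (select u (0 ∷ 2 ∷ 1 ∷ [])) v (z∈s ∷ b∈s ∷ a∈s ∷ []) zcd∈t
  ... | no _     | no _     | no _     | yes refl =
    path-meeting₂ s≢t (select u (0 ∷ 2 ∷ 1 ∷ [])) (select v (0 ∷ 2 ∷ 1 ∷ []))
      (z∈s ∷ b∈s ∷ a∈s ∷ []) (z∈t ∷ d∈t ∷ c∈t ∷ [])
  ... | no a≢c   | no a≢d   | no b≢c   | no b≢d   = path-meeting₁ s≢t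
    ((z≢a ∷ z≢b ∷ z≢c ∷ z≢d ∷ []) ∷ (a≢b ∷ a≢c ∷ a≢d ∷ []) ∷ (b≢c ∷ b≢d ∷ []) ∷ (c≢d ∷ []) ∷ [] ∷ []) zab∈s zcd∈t

  -- All distances in a star are 2 or 3, and 2 + 2 exceeds 3.
  star-generalPosition : ∀ {S z} → (∀ {s} → s ∈ S → z ∈³ s) → GeneralPosition (Kneser n 3) S
  star-generalPosition star s∈S t∈S r∈S s≢t s≢r t≢r (_ , st≤) ((sr , _) , _) ((rt , _) , _) refl
    with l , path , l≤3 ← short-path s≢t (star s∈S) (star t∈S) =
    contradiction (≤-trans (+-mono-≤ (meeting-walk s≢r (star s∈S) (star r∈S) sr)
                                     (meeting-walk (t≢r ∘ sym) (star r∈S) (star t∈S) rt))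
                           (≤-trans (st≤ l path) l≤3)) λ { (s≤s (s≤s (s≤s ()))) }

length-allOfSize : ∀ n k → length (allOfSize n k) ≡ n C k
length-allOfSize zero    zero    = refl
length-allOfSize zero    (suc k) = refl
length-allOfSize (suc n) zero    = ≡-trans (length-map _ (allOfSize n 0)) (length-allOfSize n 0)
length-allOfSize (suc n) (suc k) = begin
  length (map _ (allOfSize n k) ++ map _ (allOfSize n (suc k)))
    ≡⟨ length-++ (map _ (allOfSize n k)) ⟩
  length (map _ (allOfSize n k)) + length (map _ (allOfSize n (suc k)))
    ≡⟨ cong₂ _+_ (length-map _ (allOfSize n k)) (length-map _ (allOfSize n (suc k))) ⟩
  length (allOfSize n k) + length (allOfSize n (suc k))
    ≡⟨ cong₂ _+_ (length-allOfSize n k) (length-allOfSize n (suc k)) ⟩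
  n C k + n C suc k
    ≡⟨ nCk+nC[k+1]≡[n+1]C[k+1] n k ⟩
  suc n C suc k ∎
  where open ≡-Reasoning

tail-injective : ∀ {k l b} {s t : SubsetOfSize n k} {eq eq₁} →
                 _≡_ {A = SubsetOfSize (suc n) l} (b Vec.∷ proj₁ s , eq) (b Vec.∷ proj₁ t , eq₁) → s ≡ t
tail-injective eq = SubsetOfSize-≡ (∷-injectiveʳ (cong proj₁ eq))

allOfSize-unique : ∀ n k → Unique (allOfSize n k)
allOfSize-unique zero    zero    = [] ∷ []
allOfSize-unique zero    (suc k) = []
allOfSize-unique (suc n) zero    = Uniqueₚ.map⁺ tail-injective (allOfSize-unique n 0)
allOfSize-unique (suc n) (suc k) = Uniqueₚ.++⁺
  (Uniqueₚ.map⁺ tail-injective (allOfSize-unique n k)) (Uniqueₚ.map⁺ tail-injective (allOfSize-unique n (suc k)))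
  λ (s∈ , t∈) → let _ , _ , eq = ∈-map⁻ _ s∈; _ , _ , eq₁ = ∈-map⁻ _ t∈ in
    contradiction (cong (Vec.head ∘ proj₁) (≡-trans (sym eq) eq₁)) λ ()

star : ∀ n → List (Triple (suc n))
star n = map (λ (p , |p|) → inside Vec.∷ p , cong suc |p|) (allOfSize n 2)

star-unique : ∀ n → Unique (star n)
star-unique n = Uniqueₚ.map⁺ tail-injective (allOfSize-unique n 2)

zero∈star : ∀ {s} → s ∈ star n → zero ∈³ s
zero∈star s∈ with _ , _ , refl ← ∈-map⁻ _ s∈ = Vec.here

length-star : ∀ n → length (star n) ≡ n C 2
length-star n = ≡-trans (length-map _ (allOfSize n 2)) (length-allOfSize n 2)

gp-≥7 : ∀ n → 7 ≤ n → IsGpNumber (Kneser n 3) ((n ∸ 1) C 2)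
gp-≥7 (suc n) 7≤n with m , eq ← m≤n⇒∃[o]m+o≡n 7≤n =
  (star n , star-unique n , star-generalPosition 7≤n zero∈star , length-star n) ,
  λ S uS gp → subst (λ k → length S ≤ k C 2) (suc-injective eq) (upper-bound m (sym eq) uS gp)

-- The perfect matching K(6,3)

module _ (n≡6 : n ≡ 6) where

  -- Disjoint `r` and `s` partition the six points, so what avoids `s` falls into `r`.
  complement-⊆ : ∀ (r s t : Triple n) → r ∥ s → s ∥ t → ∀ {z} → z ∈³ t → z ∈³ r
  complement-⊆ r s t r∥s s∥t {z} z∈t
    with i , j , k , u , ijk∈r ← elements r
    with a , b , c , v , abc∈s ← elements s
    with ∈-++⁻ (i ∷ j ∷ k ∷ []) (exhaust-all (Uniqueₚ.++⁺ u v λ (z∈r , z∈s) →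
           r∥s (_ , x∈p∩q⁺ (All.lookup ijk∈r z∈r , All.lookup abc∈s z∈s))) (sym n≡6) z)
  ... | inj₁ z∈ijk = All.lookup ijk∈r z∈ijk
  ... | inj₂ z∈abc = contradiction (z , x∈p∩q⁺ (All.lookup abc∈s z∈abc , z∈t)) s∥t

  complement-≡ : ∀ (r s t : Triple n) → r ∥ s → s ∥ t → r ≡ t
  complement-≡ r s t r∥s s∥t = SubsetOfSize-≡ (⊆-antisym
    (complement-⊆ t s r (∥-sym s t s∥t) (∥-sym r s r∥s)) (complement-⊆ r s t r∥s s∥t))

  -- A triple has its complement as its only neighbour, so a walk alternates between the two.
  walk-perfect-matching : ∀ {s t l} → Walk (Kneser n 3) s t l → s ≡ t ⊎ s ∥ t
  walk-perfect-matching nil = inj₁ refl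
  walk-perfect-matching {s} {t} (cons {v = r} s∥r w) with walk-perfect-matching w
  ... | inj₁ refl = inj₂ s∥r
  ... | inj₂ r∥t  = inj₁ (complement-≡ s r t s∥r r∥t)

  -- Components have two vertices, so three different vertices never lie in one component.
  perfect-matching-generalPosition : ∀ (S : List (Triple n)) → GeneralPosition (Kneser n 3) S
  perfect-matching-generalPosition S {s} {t} {r} _ _ _ s≢t s≢r t≢r ((st , _) , _) ((sr , _) , _) _
    with walk-perfect-matching st | walk-perfect-matching sr
  ... | inj₁ s≡t | _        = contradiction s≡t s≢t
  ... | inj₂ _   | inj₁ s≡r = contradiction s≡r s≢r
  ... | inj₂ s∥t | inj₂ s∥r = contradiction (complement-≡ t s r (∥-sym s t s∥t) s∥r) t≢r

  gp-perfect-matching : IsGpNumber (Kneser n 3) (n C 3)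
  gp-perfect-matching =
    (allOfSize n 3 , allOfSize-unique n 3 , perfect-matching-generalPosition _ , length-allOfSize n 3) , λ S uS _ →
    let _ , q = extend uS (All.tabulate λ {s} _ → allOfSize-complete n 3 s) in begin
    length S                    ≤⟨ m≤m+n (length S) _ ⟩
    length S + _                ≡⟨ length-++ S ⟨
    length (S ++ _)             ≡⟨ ↭-length q ⟨
    length (allOfSize n 3)      ≡⟨ length-allOfSize n 3 ⟩
    n C 3                       ∎
    where open ≤-Reasoning

theorem2p4 : (n : ℕ) → 6 ≤ n →
    (n ≡ 6 → IsGpNumber (Kneser n 3) 20) ×
    (7 ≤ n → IsGpNumber (Kneser n 3) ((n ∸ 1) C 2))
-- Only the argument of the binomial is rewritten; `6 C 3` evaluates to 20.
theorem2p4 n _ = (λ n≡6 → subst (λ k → IsGpNumber (Kneser n 3) (k C 3)) n≡6 (gp-perfect-matching n≡6)) , gp-≥7 n
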